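{- Let $n_0 = 3\cdot 5\cdot 7\cdot 11\cdot 13\cdot 17\cdot 19\cdot 23 = 111546435$. For every integer $m$ with $2\le m<n_0$, the partition $G(m)$ of $\{2,\dots,m\}$ produced by the natural greedy algorithm is $$G(m)=\{S_{j,m} : j\ge 1,\ S_{j,m}\ne\emptyset\},$$ whereas $$G(n_0)=\{\,S_{1,n_0}\cup\{n_0\},\ S_{2,n_0}\setminus\{n_0\}\,\}\cup\{S_{j,n_0} : j\ge 3,\ S_{j,n_0}\neq\emptyset\}.$$
   Context: Let $p_i$ denote the $i$-th prime ($p_1=2$, $p_2=3,\dots$). For $i\ge1$ and a positive integer $n$, $S_{i,n}$ is the set of positive integers $m\le n$ with $p_i\mid m$ and $p_j\nmid m$ for all $j<i$ (i.e. the integers in $[2,n]$ whose smallest prime factor is $p_i$). Two distinct integers $a,b\ge 2$ are friends if $\gcd(a,b)>1$ and enemies if $\gcd(a,b)=1$. Given a partition of a finite set of integers $\ge2$, a pair $\{a,b\}$ of distinct elements is in conflict if $a,b$ are enemies in the same class, or friends in different classes. The natural greedy algorithm produces for each $n\ge 2$ a partition $G(n)$ of $\{2,\dots,n\}$, with its classes indexed, as follows. $G(2)=\{\{2\}\}$. For $n\ge3$, let $G(n-1)=\{P_1,\dots,P_M\}$, with the classes indexed in order of creation (equivalently, by increasing smallest element). The options are: (option $0$) add $\{n\}$ as a new class; (option $j$, $1\le j\le M$) replace $P_j$ by $P_j\cup\{n\}$. For each option count the conflicts among the pairs $\{a,n\}$, $2\le a<n$, in the resulting partition of $\{2,\dots,n\}$.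 Choose the option with the fewest such conflicts; if there are several, choose the one with the smallest option index. The resulting partition is $G(n)$. -}

module Defs where

open import Data.Bool using (if_then_else_)
open import Data.Fin using (Fin; zero; suc)
open import Data.List using (List; []; _∷_; [_]; _∷ʳ_; length; filter; applyUpTo; _[_]%=_)
open import Data.List.Membership.Propositional using (_∈_)
open import Data.List.Membership.DecPropositional using (_∈?_)
open import Data.List.Relation.Unary.All using (All; []; _∷_)
open import Data.List.Relation.Unary.Any using (Any; any?)
open import Data.Nat
open import Data.Nat.Divisibility
open import Data.Nat.ListAction using (product)
open import Data.Nat.GCD using (gcd)
open import Data.Nat.Primality using (Prime; prime?; prime⇒nonZero; prime⇒nonTrivial)
open import Data.Nat.Primality.Factorisation using (PrimeFactorisation; factorise)
open import Data.Nat.Properties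
open import Data.Product using (∃; _×_; _,_; proj₁)
open import Data.Sum using (_⊎_)
open import Function using (_∘_)
open import Level using (0ℓ)
open import Relation.Binary.PropositionalEquality using (_≡_; refl; sym; subst)
open import Relation.Nullary using (¬_; Dec; yes; no; does; contradiction; ¬?; _×-dec_; _⊎-dec_)
open import Relation.Unary using (Pred; _≐_)

-- Euclid's argument, used only to make the enumeration of the primes total.
∃prime> : ∀ n → ∃ λ q → n < q × Prime q
∃prime> n = fromFactors (PrimeFactorisation.factors f)
                        (PrimeFactorisation.isFactorisation f)
                        (PrimeFactorisation.factorsPrime f)
  where
  f = factorise (suc (n !))

  fromFactors : ∀ qs → suc (n !) ≡ product qs → All Prime qs →
                ∃ λ q → n < q × Prime q
  fromFactors []       eq _ = contradiction (suc-injective eq) (m<n⇒n≢0 (1≤n! n))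
  fromFactors (q ∷ qs) eq (q-prime ∷ _) with q ≤? n
  ... | no  q≰n = q , ≰⇒> q≰n , q-prime
  ... | yes q≤n = contradiction q≡1 (nonTrivial⇒≢1 {{prime⇒nonTrivial q-prime}})
    where
    q∣n!+1 : q ∣ n ! + 1
    q∣n!+1 = subst (q ∣_) (+-comm 1 (n !)) (subst (q ∣_) (sym eq) (m∣m*n _))

    q∣q! : ∀ m → .{{NonZero m}} → m ∣ m !
    q∣q! (suc m) = m∣m*n (m !)

    q≡1 : q ≡ 1
    q≡1 = ∣1⇒≡1 (∣m+n∣m⇒∣n q∣n!+1
            (∣-trans (q∣q! q {{prime⇒nonZero q-prime}}) (m≤n⇒m!∣n! q≤n)))

leastPrime≥ : ∀ d k → (∃ λ q → k ≤ q × q ≤ d + k × Prime q) →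
              ∃ λ q → k ≤ q × Prime q × (∀ {r} → k ≤ r → Prime r → q ≤ r)
leastPrime≥ d k (q , k≤q , q≤d+k , q-prime) with prime? k
... | yes k-prime = k , ≤-refl , k-prime , λ k≤r _ → k≤r
... | no ¬k-prime = step d q≤d+k
  where
  k< : ∀ {r} → k ≤ r → Prime r → k < r
  k< k≤r r-prime = ≤∧≢⇒< k≤r λ { refl → ¬k-prime r-prime }

  step : ∀ d → q ≤ d + k →
         ∃ λ q → k ≤ q × Prime q × (∀ {r} → k ≤ r → Prime r → q ≤ r)
  step zero    q≤k = contradiction (k< k≤q q-prime) (≤⇒≯ q≤k)
  step (suc d) q≤d+1+k
    with leastPrime≥ d (suc k)
           (q , k< k≤q q-prime , ≤-trans q≤d+1+k (≤-reflexive (sym (+-suc d k))) , q-prime)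
  ... | q′ , k<q′ , q′-prime , least =
    q′ , <⇒≤ k<q′ , q′-prime , λ k≤r r-prime → least (k< k≤r r-prime) r-prime

nextPrime : ∀ n → ∃ λ q → n < q × Prime q × (∀ {r} → n < r → Prime r → q ≤ r)
nextPrime n with ∃prime> n
... | q , n<q , q-prime = leastPrime≥ q (suc n) (q , n<q , m≤m+n q (suc n) , q-prime)

-- p i is the i-th prime for i ≥ 1; p 0 is a dummy starting value, excluded
-- explicitly wherever indices are quantified.
p : ℕ → ℕ
p zero    = 0
p (suc i) = proj₁ (nextPrime (p i))

S : ℕ → ℕ → Pred ℕ 0ℓ
S i n m = 1 ≤ m × m ≤ n × p i ∣ m × (∀ j → 1 ≤ j → j < i → ¬ p j ∣ m)

Friends Enemies : ℕ → ℕ → Set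
Friends a b = gcd a b > 1
Enemies a b = gcd a b ≡ 1

-- A partition is the list of its classes in order of creation, and a class is
-- a list of its elements.
Partition : Set
Partition = List (List ℕ)

SameClass : Partition → ℕ → ℕ → Set
SameClass P a b = Any (λ C → a ∈ C × b ∈ C) P

-- Only meaningful for distinct elements a, b of the underlying set.
Conflict : Partition → ℕ → ℕ → Set
Conflict P a b = (Enemies a b × SameClass P a b) ⊎ (Friends a b × ¬ SameClass P a b)

sameClass? : ∀ P a b → Dec (SameClass P a b)
sameClass? P a b = any? (λ C → (_∈?_ _≟_ a C) ×-dec (_∈?_ _≟_ b C)) P

conflict? : ∀ P a b → Dec (Conflict P a b)
conflict? P a b = ((gcd a b ≟ 1) ×-dec sameClass? P a b)
            ⊎-dec ((1 <? gcd a b) ×-dec ¬? (sameClass? P a b))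

-- The list applyUpTo (2 +_) (n ∸ 2) is 2, 3, …, n ∸ 1.
conflicts : Partition → ℕ → ℕ
conflicts P n = length (filter (λ a → conflict? P a n) (applyUpTo (2 +_) (n ∸ 2)))

Option : Partition → Set
Option P = Fin (suc (length P))

apply : (P : Partition) → ℕ → Option P → Partition
apply P n zero    = P ∷ʳ [ n ]
apply P n (suc j) = P [ j ]%= (_∷ʳ n)

-- The smallest index at which f attains its minimum.
argmin : ∀ {k} → (Fin (suc k) → ℕ) → Fin (suc k)
argmin {zero}  f = zero
argmin {suc k} f = if does (f zero ≤? f (suc i)) then zero else suc i
  where i = argmin (f ∘ suc)

greedyStep : Partition → ℕ → Partition
greedyStep P n = apply P n (argmin λ o → conflicts (apply P n o) n)

-- The values at 0 and 1 are dummies: the algorithm starts at 2.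
G : ℕ → Partition
G 0 = []
G 1 = []
G 2 = [ [ 2 ] ]
G (suc n@(suc (suc _))) = greedyStep (G n) (suc n)

-- Equality of the set of classes of P with a set 𝓕 of sets of integers, sets
-- being compared extensionally.
_≋_ : Partition → Pred (Pred ℕ 0ℓ) 0ℓ → Set₁
P ≋ 𝓕 = (∀ C → C ∈ P → 𝓕 (_∈ C))
      × (∀ X → 𝓕 X → ∃ λ C → C ∈ P × (_∈ C) ≐ X)

infix 4 _≋_

n₀ : ℕ
n₀ = 3 * 5 * 7 * 11 * 13 * 17 * 19 * 23

n₀≡111546435 : n₀ ≡ 111546435
n₀≡111546435 = refl

{-# OPTIONS --safe #-}
module Submission where

-- If the least prime factor of the composite number N = suc n is q, then
-- option 0 is worse than the class of q, all of whose members are friends of N,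
-- and so are the classes of primes above q, which are no larger.  A prime P < q
-- loses iff, among the members of its class, N has fewer friends than enemies
-- plus the size of the class of q (Wins P below).  Writing members as P * k:
--   * If N < P³, then N is a product of two primes, which are the only k giving
--     friends, while k = 1 and k = P give enemies.
--   * If N > P³ and q ≥ 7, friends are bounded by the sum of the counts of the
--     k divisible by a prime factor of N, and the size of the class of P from
--     below by sieving with 2, 3, 5, 7 exactly and subtracting the multiples of
--     the other primes below P.  The prime factors of N dominate termwise the
--     first primes above P, so finitely many numerical inequalities suffice,
--     because P³ < N < n₀ bounds P and N < n₀ bounds the number of factors.
--   * If q = 5 and P = 3, the same works once the class of 5 is taken into account.
--   * If P = 2, half of the totatives of N are below N / 2, and Legendre's formula
--     gives friends and enemies exactly: for q = 3 the class of 2 loses iff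
--     3 φ(N) > N, which first fails for N = 3 · 5 · … · 23 = n₀.

open import Defs
open import Data.Bool using (Bool; true; false; _∧_; _∨_; T; T?; if_then_else_)
open import Data.Fin as Fin using (Fin; zero; suc; toℕ; fromℕ<)
open import Data.Fin.Properties using (toℕ-fromℕ<)
open import Data.List using (List; []; _∷_; [_]; _∷ʳ_; _++_; map; filter; upTo; length; lookup; applyUpTo; _[_]%=_)
open import Data.List.Membership.Propositional using (_∈_; _∉_; lose; find)
open import Data.List.Membership.Propositional.Properties using (∈-filter⁺; ∈-filter⁻; ∈-upTo⁺; ∈-++⁺ˡ; ∈-++⁺ʳ; ∈-++⁻)
open import Data.List.Properties using (applyUpTo-∷ʳ; filter-++; length-++; filter-reject; length-%=)
open import Data.List.Relation.Binary.Pointwise using (Pointwise; []; _∷_)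
open import Data.List.Relation.Binary.Pointwise.Properties using () renaming (refl to Pointwise-refl)
open import Data.List.Relation.Unary.All as All using (All; []; _∷_; all?)
open import Data.List.Relation.Unary.AllPairs using (AllPairs; []; _∷_; allPairs?)
import Data.List.Relation.Unary.AllPairs.Properties as AllPairs
open import Data.List.Relation.Unary.Any using (Any; here; there; any?)
import Data.List.Relation.Unary.Any.Properties as Any
open import Data.Nat
open import Data.Nat.Coprimality using (prime⇒coprime; coprime⇒gcd≡1) renaming (sym to coprime-sym)
open import Data.Nat.DivMod using (m/n*n≤m; m≡m%n+[m/n]*n; m%n<n)
open import Data.Nat.Divisibility
open import Data.Nat.GCD
open import Data.Nat.ListAction using (sum; product)
open import Data.Nat.ListAction.Properties using (product≢0)
open import Data.Nat.Primality
open import Data.Nat.Primality.Factorisation using (factorisationHasAllPrimeFactors)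
open import Data.Nat.Properties
open import Data.Nat.Tactic.RingSolver using (solve-∀)
open import Data.List.Membership.DecPropositional _≟_ using (_∈?_)
open import Data.Product using (_×_; _,_; proj₁; proj₂; ∃; ∃-syntax)
open import Data.Sum using (_⊎_; inj₁; inj₂; [_,_]′)
open import Data.Unit using (tt)
open import Function using (_∘_; id)
open import Level using (0ℓ)
open import Relation.Binary using (tri<; tri≈; tri>)
open import Relation.Binary.PropositionalEquality hiding ([_])
open import Relation.Nullary
open import Relation.Nullary.Decidable using (map′; toWitness; dec-true; dec-false; _→-dec_)
open import Relation.Unary using (Pred; Decidable; Satisfiable; _≐_; _∪_; _∖_; ｛_｝)

private variable
  Y Z : Set
  Q R V W : Pred ℕ 0ℓ
  P d k l m n q r : ℕ
  L qs rs : List ℕ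

-- Counting

⟦_⟧ : Dec Y → ℕ
⟦ a? ⟧ = if does a? then 1 else 0

count : Decidable Q → ℕ → ℕ
count Q? zero    = 0
count Q? (suc m) = ⟦ Q? (suc m) ⟧ + count Q? m

⟦⟧-yes : (a? : Dec Y) → Y → ⟦ a? ⟧ ≡ 1
⟦⟧-yes (yes _) _ = refl
⟦⟧-yes (no ¬a) a = contradiction a ¬a

⟦⟧-no : (a? : Dec Y) → ¬ Y → ⟦ a? ⟧ ≡ 0
⟦⟧-no (yes a) ¬a = contradiction a ¬a
⟦⟧-no (no _)  _  = refl

⟦⟧-mono : (a? : Dec Y) (b? : Dec Z) → (Y → Z) → ⟦ a? ⟧ ≤ ⟦ b? ⟧
⟦⟧-mono (no _)  b? f = z≤n
⟦⟧-mono (yes a) b? f = ≤-reflexive (sym (⟦⟧-yes b? (f a)))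

⟦⟧≤1 : (a? : Dec Y) → ⟦ a? ⟧ ≤ 1
⟦⟧≤1 (yes _) = ≤-refl
⟦⟧≤1 (no _)  = z≤n

count-mono : ∀ m (Q? : Decidable Q) (R? : Decidable R) →
             (∀ {k} → 1 ≤ k → k ≤ m → Q k → R k) → count Q? m ≤ count R? m
count-mono zero    Q? R? f = z≤n
count-mono (suc m) Q? R? f =
  +-mono-≤ (⟦⟧-mono (Q? (suc m)) (R? (suc m)) (f (s≤s z≤n) ≤-refl))
           (count-mono m Q? R? λ 1≤k k≤m → f 1≤k (m≤n⇒m≤1+n k≤m))

count-cong : ∀ m (Q? : Decidable Q) (R? : Decidable R) →
             (∀ {k} → 1 ≤ k → k ≤ m → Q k → R k) →
             (∀ {k} → 1 ≤ k → k ≤ m → R k → Q k) → count Q? m ≡ count R? m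
count-cong m Q? R? f g = ≤-antisym (count-mono m Q? R? f) (count-mono m R? Q? g)

count-monoʳ : (Q? : Decidable Q) → m ≤ n → count Q? m ≤ count Q? n
count-monoʳ {m = m} Q? m≤n = go (≤⇒≤′ m≤n)
  where
  go : ∀ {n} → m ≤′ n → count Q? m ≤ count Q? n
  go ≤′-refl        = ≤-refl
  go (≤′-step m≤′n) = ≤-trans (go m≤′n) (m≤n+m _ _)

count-< : (Q? : Decidable Q) → m < n → Q n → count Q? m < count Q? n
count-< {n = suc n} Q? (s≤s m≤n) q rewrite ⟦⟧-yes (Q? (suc n)) q = s≤s (count-monoʳ Q? m≤n)

count-none : ∀ m (Q? : Decidable Q) → (∀ {k} → 1 ≤ k → k ≤ m → ¬ Q k) → count Q? m ≡ 0
count-none zero    Q? f = refl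
count-none (suc m) Q? f =
  cong₂ _+_ (⟦⟧-no (Q? (suc m)) (f (s≤s z≤n) ≤-refl))
            (count-none m Q? λ 1≤k k≤m → f 1≤k (m≤n⇒m≤1+n k≤m))

+-interchange : ∀ a b c d → (a + b) + (c + d) ≡ (a + c) + (b + d)
+-interchange = solve-∀

-- Sums stand on both sides so that an identity with subtracted terms, such as `cost-suc`, follows
-- from its pointwise form without subtraction in ℕ.
count-+ : ∀ m (Q? : Decidable Q) (R? : Decidable R) (V? : Decidable V) (W? : Decidable W) →
          (∀ {k} → 1 ≤ k → k ≤ m → ⟦ Q? k ⟧ + ⟦ R? k ⟧ ≡ ⟦ V? k ⟧ + ⟦ W? k ⟧) →
          count Q? m + count R? m ≡ count V? m + count W? m
count-+ zero    Q? R? V? W? f = refl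
count-+ (suc m) Q? R? V? W? f = begin
  (⟦ Q? (suc m) ⟧ + count Q? m) + (⟦ R? (suc m) ⟧ + count R? m) ≡⟨ +-interchange ⟦ Q? (suc m) ⟧ _ _ _ ⟩
  (⟦ Q? (suc m) ⟧ + ⟦ R? (suc m) ⟧) + (count Q? m + count R? m)
    ≡⟨ cong₂ _+_ (f (s≤s z≤n) ≤-refl)
                 (count-+ m Q? R? V? W? λ 1≤k k≤m → f 1≤k (m≤n⇒m≤1+n k≤m)) ⟩
  (⟦ V? (suc m) ⟧ + ⟦ W? (suc m) ⟧) + (count V? m + count W? m) ≡⟨ +-interchange ⟦ V? (suc m) ⟧ _ _ _ ⟨
  (⟦ V? (suc m) ⟧ + count V? m) + (⟦ W? (suc m) ⟧ + count W? m) ∎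
  where
  open ≡-Reasoning

infixr 2 _∩?_
_∩?_ : Decidable Q → Decidable R → Decidable (λ k → Q k × R k)
(Q? ∩? R?) k = Q? k ×-dec R? k

∁? : Decidable Q → Decidable (λ k → ¬ Q k)
∁? Q? k = ¬? (Q? k)

count-split : ∀ m (Q? : Decidable Q) (R? : Decidable R) →
              count Q? m ≡ count (Q? ∩? R?) m + count (Q? ∩? ∁? R?) m
count-split zero    Q? R? = refl
count-split (suc m) Q? R? = trans
  (cong₂ _+_ (split (Q? (suc m)) (R? (suc m))) (count-split m Q? R?))
  (+-interchange ⟦ (Q? ∩? R?) (suc m) ⟧ _ _ _)
  where
  split : (a? : Dec Y) (b? : Dec Z) → ⟦ a? ⟧ ≡ ⟦ a? ×-dec b? ⟧ + ⟦ a? ×-dec ¬? b? ⟧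
  split (yes _) (yes _) = refl
  split (yes _) (no _)  = refl
  split (no _)  _       = refl

count-∪ : ∀ m (Q? : Decidable Q) (R? : Decidable R) (V? : Decidable V) →
          (∀ {k} → 1 ≤ k → k ≤ m → Q k → R k ⊎ V k) →
          count Q? m ≤ count R? m + count V? m
count-∪ {R = R} {V = V} m Q? R? V? f = begin
  count Q? m                                        ≡⟨ count-split m Q? R? ⟩
  count (Q? ∩? R?) m + count (Q? ∩? ∁? R?) m
    ≤⟨ +-mono-≤ (count-mono m (Q? ∩? R?) R? λ _ _ → proj₂)
                (count-mono m (Q? ∩? ∁? R?) V? λ { 1≤k k≤m (q , ¬r) → [r,t] ¬r (f 1≤k k≤m q) }) ⟩
  count R? m + count V? m                           ∎
  where
  open ≤-Reasoning
  [r,t] : ∀ {k} → ¬ R k → R k ⊎ V k → V k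
  [r,t] ¬r (inj₁ r) = contradiction r ¬r
  [r,t] ¬r (inj₂ t) = t

-- Floor division made total: the junk value is x ÷ 0 = 0.
infixl 7 _÷_
_÷_ : ℕ → ℕ → ℕ
x ÷ zero  = 0
x ÷ suc d = x / suc d

÷-*-≤ : ∀ x d → x ÷ d * d ≤ x
÷-*-≤ x zero    = z≤n
÷-*-≤ x (suc d) = m/n*n≤m x (suc d)

<-÷-* : ∀ x d → 1 ≤ d → x < suc (x ÷ d) * d
<-÷-* x (suc d) _ = begin-strict
  x                                   ≡⟨ m≡m%n+[m/n]*n x (suc d) ⟩
  x % suc d + x / suc d * suc d       <⟨ +-monoˡ-< _ (m%n<n x (suc d)) ⟩
  suc d + x / suc d * suc d           ∎
  where open ≤-Reasoning

≤-÷ : ∀ {l d x} → 1 ≤ d → l * d ≤ x → l ≤ x ÷ d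
≤-÷ {l} {d} {x} 1≤d ld≤x = ≤-pred (*-cancelʳ-< d l (suc (x ÷ d)) (≤-<-trans ld≤x (<-÷-* x d 1≤d)))

÷-≤ : ∀ {l d x} → 1 ≤ d → x < suc l * d → x ÷ d ≤ l
÷-≤ {l} {d} {x} 1≤d x<ld = ≤-pred (*-cancelʳ-< d (x ÷ d) (suc l) (≤-<-trans (÷-*-≤ x d) x<ld))

÷-≡ : ∀ {l d x} → 1 ≤ d → l * d ≤ x → x < suc l * d → x ÷ d ≡ l
÷-≡ 1≤d lo hi = ≤-antisym (÷-≤ 1≤d hi) (≤-÷ 1≤d lo)

count-multiples : ∀ m (Q? : Decidable Q) → 1 ≤ d →
                  count ((d ∣?_) ∩? Q?) m ≡ count (λ l → Q? (d * l)) (m ÷ d)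
count-multiples {Q = Q} {d = suc d′} m Q? _ =
  go m (m / e) (m % e) (m%n<n m e) (m≡m%n+[m/n]*n m e)
  where
  e = suc d′
  -- `l` and `r` are quotient and remainder of `m`. At remainder 0 the multiple `e * l` is met and
  -- `r` restarts at `d′`; otherwise `r` drops by one and nothing is counted.
  go : ∀ m l r → r < e → m ≡ r + l * e →
       count ((e ∣?_) ∩? Q?) m ≡ count (λ l → Q? (e * l)) l
  go zero    zero    r       _       _  = refl
  go zero    (suc l) r       _       eq =
    contradiction (trans eq (+-comm r _)) λ ()
  go (suc m) (suc l) zero    _       eq = cong₂ _+_
    (≤-antisym (⟦⟧-mono (((e ∣?_) ∩? Q?) (suc m)) (Q? (e * suc l)) λ (_ , q) → subst Q eq′ q)
               (⟦⟧-mono (Q? (e * suc l)) (((e ∣?_) ∩? Q?) (suc m)) λ q →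
                  divides (suc l) eq , subst Q (sym eq′) q))
    (go m l d′ ≤-refl (suc-injective eq))
    where
    eq′ : suc m ≡ e * suc l
    eq′ = trans eq (*-comm (suc l) e)
  go (suc m) l       (suc r) r<e     eq = cong₂ _+_
    (⟦⟧-no (((e ∣?_) ∩? Q?) (suc m)) λ (d∣m , _) →
      >⇒∤ r<e (∣m+n∣m⇒∣n (subst (e ∣_) (trans eq (+-comm (suc r) _)) d∣m) (n∣m*n l)))
    (go m l r (<-trans (n<1+n r) r<e) (suc-injective eq))

count-periodic : ∀ {w} (Q? : Decidable Q) → (∀ {k} → Q k → Q (k + w)) → (∀ {k} → Q (k + w) → Q k) →
                 ∀ m → count Q? (m + w) ≡ count Q? m + count Q? w
count-periodic Q? f g zero    = refl
count-periodic {w = w} Q? f g (suc m) = trans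
  (cong₂ _+_ (≤-antisym (⟦⟧-mono (Q? (suc m + w)) (Q? (suc m)) g)
                        (⟦⟧-mono (Q? (suc m)) (Q? (suc m + w)) f))
             (count-periodic Q? f g m))
  (sym (+-assoc ⟦ Q? (suc m) ⟧ (count Q? m) (count Q? w)))

-- Divisibility by some member of a list

AnyDivides : List ℕ → Pred ℕ 0ℓ
AnyDivides qs k = Any (_∣ k) qs

anyDivides? : ∀ qs → Decidable (AnyDivides qs)
anyDivides? qs k = any? (_∣? k) qs

-- A union bound over `qs`. The cofactor is only required to satisfy `R`, which can be a sieve
-- condition that is easier to count than `Q`.
count-anyDivides : ∀ m (Q? : Decidable Q) (R? : Decidable R) → ∀ qs → All (1 ≤_) qs →
                   (∀ q {l} → Q (q * l) → R l) →
                   count (Q? ∩? anyDivides? qs) m ≤ sum (map (λ q → count R? (m ÷ q)) qs)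
count-anyDivides m Q? R? [] [] f = ≤-reflexive (count-none m (Q? ∩? anyDivides? []) λ { _ _ (_ , ()) })
count-anyDivides m Q? R? (q ∷ qs) (1≤q ∷ 1≤qs) f = begin
  count (Q? ∩? anyDivides? (q ∷ qs)) m
    ≤⟨ count-∪ m (Q? ∩? anyDivides? (q ∷ qs)) ((q ∣?_) ∩? Q?) (Q? ∩? anyDivides? qs)
         (λ { _ _ (x , here q∣k) → inj₁ (q∣k , x) ; _ _ (x , there a) → inj₂ (x , a) }) ⟩
  count ((q ∣?_) ∩? Q?) m + count (Q? ∩? anyDivides? qs) m
    ≤⟨ +-mono-≤ (≤-trans (≤-reflexive (count-multiples m Q? 1≤q))
                         (count-mono (m ÷ q) (λ l → Q? (q * l)) R? λ _ _ → f q))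
                (count-anyDivides m Q? R? qs 1≤qs f) ⟩
  count R? (m ÷ q) + sum (map (λ q → count R? (m ÷ q)) qs) ∎
  where open ≤-Reasoning

-- Prime factors and roughness

prime⇒2≤ : Prime q → 2 ≤ q
prime⇒2≤ q-prime = nonTrivial⇒n>1 _ {{prime⇒nonTrivial q-prime}}

prime⇒1≤ : Prime q → 1 ≤ q
prime⇒1≤ q-prime = <⇒≤ (prime⇒2≤ q-prime)

infix 10 _rough?_
_rough?_ : ∀ P → Decidable (P Rough_)
P rough? n = ¬? (map′ to from (anyUpTo? (λ d → (1 <? d) ×-dec (d ∣? n)) P))
  where
  to : (∃ λ d → d < P × 1 < d × d ∣ n) → n HasNonTrivialDivisorLessThan P
  to (d , d<P , 1<d , d∣n) = hasNonTrivialDivisor {{n>1⇒nonTrivial 1<d}} d<P d∣n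
  from : n HasNonTrivialDivisorLessThan P → ∃ λ d → d < P × 1 < d × d ∣ n
  from (hasNonTrivialDivisor {d} d<P d∣n) = d , d<P , nonTrivial⇒n>1 d , d∣n

rough⇒≥ : ∀ {d} → P Rough n → 2 ≤ d → d ∣ n → P ≤ d
rough⇒≥ P-rough 2≤d d∣n =
  ≮⇒≥ λ d<P → P-rough (hasNonTrivialDivisor {{n>1⇒nonTrivial 2≤d}} d<P d∣n)

smallestFactor : ∀ n → 2 ≤ n → ∃ λ q → Prime q × q ∣ n × q Rough n
smallestFactor n 2≤n = go n 0 (+-identityʳ n) 0-rough
  where
  instance n-nonTrivial = n>1⇒nonTrivial 2≤n
  go : ∀ fuel P → fuel + P ≡ n → P Rough n → ∃ λ q → Prime q × q ∣ n × q Rough n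
  -- Every candidate below `n` has been rejected, so `n` is its own least prime factor.
  go zero       P refl P-rough = n , prime P-rough , ∣-refl , P-rough
  go (suc fuel) P eq   P-rough with (1 <? P) ×-dec (P ∣? n)
  ... | yes (1<P , P∣n) = P , rough∧∣⇒prime {{n>1⇒nonTrivial 1<P}} P-rough P∣n , P∣n , P-rough
  ... | no  ¬P = go fuel (suc P) (trans (+-suc fuel P) eq) suc-rough
    where
    suc-rough : suc P Rough n
    suc-rough (hasNonTrivialDivisor {d} d<1+P d∣n) with m<1+n⇒m<n∨m≡n d<1+P
    ... | inj₁ d<P  = P-rough (hasNonTrivialDivisor d<P d∣n)
    ... | inj₂ refl = ¬P (nonTrivial⇒n>1 d , d∣n)

∤⇒rough : (∀ {r} → Prime r → r < P → ¬ r ∣ n) → P Rough n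
∤⇒rough f (hasNonTrivialDivisor {d} d<P d∣n) with smallestFactor d (nonTrivial⇒n>1 d)
... | r , r-prime , r∣d , _ =
  f r-prime (≤-<-trans (∣⇒≤ {{nonTrivial⇒nonZero d}} r∣d) d<P) (∣-trans r∣d d∣n)

rough⇒∤ : P Rough n → Prime r → r < P → ¬ r ∣ n
rough⇒∤ P-rough r-prime r<P r∣n = <⇒≱ r<P (rough⇒≥ P-rough (prime⇒2≤ r-prime) r∣n)

prime-∣-prime : Prime q → Prime r → q ∣ r → q ≡ r
prime-∣-prime q-prime r-prime q∣r with prime⇒irreducible r-prime q∣r
... | inj₁ refl = contradiction q-prime ¬prime[1]
... | inj₂ q≡r  = q≡r

rough-* : Prime q → P ≤ q → P Rough l → P Rough (q * l)
rough-* q-prime P≤q l-rough = ∤⇒rough λ r-prime r<P r∣ql →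
  [ (λ r∣q → <⇒≢ (<-≤-trans r<P P≤q) (prime-∣-prime r-prime q-prime r∣q))
  , rough⇒∤ l-rough r-prime r<P ]′ (euclidsLemma _ _ r-prime r∣ql)

-- The distinct prime factors of `n` in increasing order. Multiplicities are left out, since being a
-- friend of `n` depends only on which primes divide it.
record Support (n : ℕ) (qs : List ℕ) : Set where
  field
    sorted   : AllPairs _<_ qs
    primes   : All Prime qs
    divide   : All (_∣ n) qs
    complete : Prime q → q ∣ n → q ∈ qs

support : ∀ n → 1 ≤ n → ∃ (Support n)
support n 1≤n = filter good? (upTo (suc n)) , record
  { sorted   = AllPairs.filter⁺ good? (AllPairs.applyUpTo⁺₁ id (suc n) λ i<j _ → i<j)
  ; primes   = All.tabulate (proj₁ ∘ proj₂ ∘ ∈-filter⁻ good? {xs = upTo (suc n)})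
  ; divide   = All.tabulate (proj₂ ∘ proj₂ ∘ ∈-filter⁻ good? {xs = upTo (suc n)})
  ; complete = λ q-prime q∣n → ∈-filter⁺ good?
      (∈-upTo⁺ (s≤s (∣⇒≤ {{>-nonZero 1≤n}} q∣n))) (q-prime , q∣n)
  }
  where
  good? : Decidable (λ q → Prime q × q ∣ n)
  good? q = prime? q ×-dec (q ∣? n)

product-∣ : ∀ {qs} → AllPairs _<_ qs → All Prime qs → All (_∣ n) qs → product qs ∣ n
product-∣ {n} [] [] [] = 1∣ n
product-∣ {qs = q ∷ qs} (q<qs ∷ sorted) (q-prime ∷ primes) (q∣n ∷ divide)
  with product-∣ sorted primes divide
... | divides c refl with euclidsLemma c (product qs) q-prime q∣n
...   | inj₁ q∣c = *-monoˡ-∣ (product qs) q∣c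
-- A prime dividing the product of the tail is an entry of the tail, but all those entries exceed
-- `q`.
...   | inj₂ q∣Π = contradiction refl
        (<⇒≢ (All.lookup q<qs (factorisationHasAllPrimeFactors q-prime q∣Π primes)))

friends⇒anyDivides : ∀ {a} → Support n qs → 1 ≤ n → gcd a n > 1 → AnyDivides qs a
friends⇒anyDivides {n = n} {a = a} supp 1≤n g>1
  with smallestFactor (gcd a n) g>1
... | r , r-prime , r∣g , _ =
  lose (Support.complete supp r-prime (∣-trans r∣g (gcd[m,n]∣n a n))) (∣-trans r∣g (gcd[m,n]∣m a n))

anyDivides⇒friends : ∀ {a} → Support n qs → 1 ≤ n → AnyDivides qs a → gcd a n > 1
anyDivides⇒friends {n = n} {a = a} supp 1≤n any with find any
... | r , r∈qs , r∣a = <-≤-trans (prime⇒2≤ (All.lookup (Support.primes supp) r∈qs))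
  (∣⇒≤ {{≢-nonZero λ g≡0 → <⇒≢ 1≤n (sym (gcd[m,n]≡0⇒n≡0 a g≡0))}}
       (gcd-greatest r∣a (All.lookup (Support.divide supp) r∈qs)))

anyDivides-*⁻ : ∀ {qs} → Prime q → All Prime qs → All (λ r → ¬ r ∣ q) qs → AnyDivides qs (q * l) → AnyDivides qs l
anyDivides-*⁻ {q} {l} q-prime (r-prime ∷ _) (r∤q ∷ _) (here r∣ql)
  with euclidsLemma q l r-prime r∣ql
... | inj₁ r∣q = contradiction r∣q r∤q
... | inj₂ r∣l = here r∣l
anyDivides-*⁻ q-prime (_ ∷ primes) (_ ∷ ∤s) (there any) = there (anyDivides-*⁻ q-prime primes ∤s any)

anyDivides-*⁺ : ∀ q → AnyDivides qs l → AnyDivides qs (q * l)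
anyDivides-*⁺ q (here r∣l)  = here (∣n⇒∣m*n q r∣l)
anyDivides-*⁺ q (there any) = there (anyDivides-*⁺ q any)

-- Prefixes of L bound the corresponding entries of qs from below.
infix 4 _≼_
data _≼_ : List ℕ → List ℕ → Set where
  stop : [] ≼ qs
  done : L ≼ []
  _∷_  : r ≤ q → L ≼ qs → r ∷ L ≼ q ∷ qs

-- An entry of `qs` is either in `L` or at least as large as all of `L`, and both lists increase
-- strictly; so no entry of `qs` can fall behind the entry of `L` at the same place.
sorted⇒≼ : AllPairs _<_ L → AllPairs _<_ qs → All (λ q → q ∈ L ⊎ All (_≤ q) L) qs → L ≼ qs
sorted⇒≼ []              _                []         = done
sorted⇒≼ []              _                (_ ∷ _)    = stop
sorted⇒≼ (_ ∷ _)         []               []         = done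
sorted⇒≼ (r<L ∷ L-sorted) (q<qs ∷ qs-sorted) (q∈ ∷ qs∈) =
  r≤q q∈ ∷ sorted⇒≼ L-sorted qs-sorted (All.zipWith (λ (q<q′ , q′∈) → tail q<q′ q′∈) (q<qs , qs∈))
  where
  r≤q : _ → _
  r≤q (inj₁ (here refl))  = ≤-refl
  r≤q (inj₁ (there q∈L))  = <⇒≤ (All.lookup r<L q∈L)
  r≤q (inj₂ (r≤q ∷ _))    = r≤q
  tail : ∀ {q′} → _ < q′ → q′ ∈ _ ∷ _ ⊎ All (_≤ q′) (_ ∷ _) → q′ ∈ _ ⊎ All (_≤ q′) _
  tail q<q′ (inj₁ (here refl))  = contradiction q<q′ (≤⇒≯ (r≤q q∈))
  tail q<q′ (inj₁ (there q′∈L)) = inj₁ q′∈L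
  tail q<q′ (inj₂ (_ ∷ L≤q′))   = inj₂ L≤q′

-- Whether t holds of every prefix of L whose product is below b; false when
-- L is too short to decide this.
scan : (List ℕ → Bool) → ℕ → ℕ → List ℕ → Bool
scan t b Π []      = false
scan t b Π (r ∷ L) = t [] ∧ ((b ≤ᵇ Π * r) ∨ scan (t ∘ (r ∷_)) b (Π * r) L)

∧-T : ∀ {x y} → T (x ∧ y) → T x × T y
∧-T {true} {true} _ = _ , _

∨-T : ∀ {x y} → T (x ∨ y) → T x ⊎ T y
∨-T {true}  _ = inj₁ _
∨-T {false} y = inj₂ y

-- The entries of a prefix of `L` are bounded by those of `qs`, so its product stays below `b` and
-- the scan is not cut off before the prefix has the length of `qs`. That prefix is `rs`.
scan-sound : ∀ {t b L} Π → T (scan t b Π L) → L ≼ qs → All (1 ≤_) qs → Π * product qs < b →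
             ∃ λ rs → Pointwise _≤_ rs qs × T (t rs)
scan-sound {L = r ∷ L} Π ok done _ _ = [] , [] , proj₁ (∧-T ok)
scan-sound {qs = q ∷ qs} {t} {b} {r ∷ L} Π ok (r≤q ∷ L≼qs) (1≤q ∷ 1≤qs) Π<b
  with ∨-T {b ≤ᵇ Π * r} (proj₂ (∧-T {t []} ok))
... | inj₁ b≤Πr = contradiction Π<b (≤⇒≯ (begin
        b                    ≤⟨ ≤ᵇ⇒≤ b (Π * r) b≤Πr ⟩
        Π * r                ≤⟨ *-monoʳ-≤ Π r≤q ⟩
        Π * q                ≤⟨ *-monoʳ-≤ Π (m≤m*n q (product qs) {{product≢0 (All.map (λ 1≤q → >-nonZero 1≤q) 1≤qs)}}) ⟩
        Π * (q * product qs) ∎))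
  where open ≤-Reasoning
... | inj₂ ok′ with scan-sound (Π * r) ok′ L≼qs 1≤qs (≤-<-trans (begin
        Π * r * product qs   ≤⟨ *-monoˡ-≤ (product qs) (*-monoʳ-≤ Π r≤q) ⟩
        Π * q * product qs   ≡⟨ *-assoc Π q (product qs) ⟩
        Π * (q * product qs) ∎) Π<b)
  where open ≤-Reasoning
...   | rs , rs≤qs , ok″ = r ∷ rs , r≤q ∷ rs≤qs , ok″

-- The sieve is needed for P³ < n₀, that is P ≤ 479, and the product of the eight
-- primes that follow P is at least n₀.
primesTo541 : List ℕ
primesTo541 =
  2 ∷ 3 ∷ 5 ∷ 7 ∷ 11 ∷ 13 ∷ 17 ∷ 19 ∷ 23 ∷ 29 ∷
  31 ∷ 37 ∷ 41 ∷ 43 ∷ 47 ∷ 53 ∷ 59 ∷ 61 ∷ 67 ∷ 71 ∷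
  73 ∷ 79 ∷ 83 ∷ 89 ∷ 97 ∷ 101 ∷ 103 ∷ 107 ∷ 109 ∷ 113 ∷
  127 ∷ 131 ∷ 137 ∷ 139 ∷ 149 ∷ 151 ∷ 157 ∷ 163 ∷ 167 ∷ 173 ∷
  179 ∷ 181 ∷ 191 ∷ 193 ∷ 197 ∷ 199 ∷ 211 ∷ 223 ∷ 227 ∷ 229 ∷
  233 ∷ 239 ∷ 241 ∷ 251 ∷ 257 ∷ 263 ∷ 269 ∷ 271 ∷ 277 ∷ 281 ∷
  283 ∷ 293 ∷ 307 ∷ 311 ∷ 313 ∷ 317 ∷ 331 ∷ 337 ∷ 347 ∷ 349 ∷
  353 ∷ 359 ∷ 367 ∷ 373 ∷ 379 ∷ 383 ∷ 389 ∷ 397 ∷ 401 ∷ 409 ∷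
  419 ∷ 421 ∷ 431 ∷ 433 ∷ 439 ∷ 443 ∷ 449 ∷ 457 ∷ 461 ∷ 463 ∷
  467 ∷ 479 ∷ 487 ∷ 491 ∷ 499 ∷ 503 ∷ 509 ∷ 521 ∷ 523 ∷ 541 ∷ []

primesTo541-sorted : AllPairs _<_ primesTo541
primesTo541-sorted = toWitness {a? = allPairs? _<?_ primesTo541} _

-- Completeness of the table by trial division: a number up to 541 that is missing from it is below
-- 2 or has a proper divisor in the table.
covered : All (λ k → k ∈ primesTo541 ⊎ k < 2 ⊎ Any (λ d → 1 < d × d < k × d ∣ k) primesTo541)
              (upTo 542)
covered = toWitness {a? = all? (λ k → (k ∈? primesTo541) ⊎-dec ((k <? 2) ⊎-dec
  any? (λ d → (1 <? d) ×-dec ((d <? k) ×-dec (d ∣? k))) primesTo541)) (upTo 542)} _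

prime⇒∈primesTo541 : Prime r → r ∈ primesTo541 ⊎ 541 < r
prime⇒∈primesTo541 {r} r-prime with r <? 542
... | no  r≮542 = inj₂ (≮⇒≥ r≮542)
... | yes r<542 = [ inj₁ , [ (λ r<2 → contradiction (prime⇒2≤ r-prime) (<⇒≱ r<2))
                           , (λ any → contradiction any (¬divisible ∘ find)) ]′ ]′
                  (All.lookup covered (∈-upTo⁺ r<542))
  where
  ¬divisible : ¬ ∃ λ d → d ∈ primesTo541 × 1 < d × d < r × d ∣ r
  ¬divisible (d , _ , 1<d , d<r , d∣r) =
    composite⇒¬prime (hasNonTrivialDivisor {{n>1⇒nonTrivial 1<d}} d<r d∣r) r-prime

primesAbove : ℕ → List ℕ
primesAbove c = filter (c <?_) primesTo541

primesAbove-≼ : ∀ c → AllPairs _<_ qs → All Prime qs → All (c <_) qs → primesAbove c ≼ qs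
primesAbove-≼ c sorted primes c<qs =
  sorted⇒≼ (AllPairs.filter⁺ (c <?_) primesTo541-sorted) sorted
    (All.zipWith (λ (q-prime , c<q) → [ (λ q∈ → inj₁ (∈-filter⁺ (c <?_) q∈ c<q))
                                      , (λ 541<q → inj₂ (All.tabulate λ r∈ →
                                          ≤-trans (All.lookup ≤541 (proj₁ (∈-filter⁻ (c <?_) {xs = primesTo541} r∈)))
                                                  (<⇒≤ 541<q))) ]′
                                      (prime⇒∈primesTo541 q-prime))
                 (primes , c<qs))
  where
  ≤541 : All (_≤ 541) primesTo541
  ≤541 = toWitness {a? = all? (_≤? 541) primesTo541} _

-- Sieve estimates

avoids? : ∀ bs → Decidable (λ k → ¬ AnyDivides bs k)
avoids? bs = ∁? (anyDivides? bs)

anyDivides-+⁺ : ∀ {w bs} → All (_∣ w) bs → AnyDivides bs k → AnyDivides bs (k + w)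
anyDivides-+⁺ (r∣w ∷ _)  (here r∣k)  = here (∣m∣n⇒∣m+n r∣k r∣w)
anyDivides-+⁺ (_ ∷ bs∣w) (there any) = there (anyDivides-+⁺ bs∣w any)

anyDivides-+⁻ : ∀ {w bs} → All (_∣ w) bs → AnyDivides bs (k + w) → AnyDivides bs k
anyDivides-+⁻ {k} {w} (_∷_ {x = r} r∣w _) (here r∣k+w) =
  here (∣m+n∣m⇒∣n (subst (r ∣_) (+-comm k w) r∣k+w) r∣w)
anyDivides-+⁻ (_ ∷ bs∣w) (there any) = there (anyDivides-+⁻ bs∣w any)

-- Among 1, …, m the numbers avoiding sieve have density num / den, with
-- the counting error controlled by over and under.
record Density : Set where
  field
    sieve              : List ℕ
    den num under over : ℕ
    1≤den : 1 ≤ den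
    1≤num : 1 ≤ num
    upper : ∀ m → den * count (avoids? sieve) m ≤ num * m + over
    lower : ∀ m → num * m ≤ den * count (avoids? sieve) m + under

  A : ℕ → ℕ
  A = count (avoids? sieve)

-- Checking one period is enough: by `period`, a shift of `m` by `w` adds `num * w` to both sides of
-- each bound.
periodicDensity : ∀ bs w den num under over → .{{NonZero w}} → 1 ≤ den → 1 ≤ num →
  All (_∣ w) bs →
  All (λ m → den * count (avoids? bs) m ≤ num * m + over
           × num * m ≤ den * count (avoids? bs) m + under) (upTo w) →
  den * count (avoids? bs) w ≡ num * w → Density
periodicDensity bs w den num under over 1≤den 1≤num bs∣w check period = record
  { sieve = bs ; den = den ; num = num ; under = under ; over = over
  ; 1≤den = 1≤den ; 1≤num = 1≤num
  ; upper = λ m → proj₁ (bounds m)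
  ; lower = λ m → proj₂ (bounds m)
  }
  where
  A = count (avoids? bs)
  Bounds : ℕ → Set
  Bounds m = den * A m ≤ num * m + over × num * m ≤ den * A m + under

  shift : ∀ a b c → a + b + c ≡ a + c + b
  shift = solve-∀

  step : ∀ m → Bounds m → Bounds (m + w)
  step m (hi , lo) =
    (begin
      den * A (m + w)          ≡⟨ eq ⟩
      den * A m + num * w      ≤⟨ +-monoˡ-≤ (num * w) hi ⟩
      num * m + over + num * w ≡⟨ shift (num * m) over (num * w) ⟩
      num * m + num * w + over ≡⟨ cong (_+ over) (*-distribˡ-+ num m w) ⟨
      num * (m + w) + over     ∎) ,
    (begin
      num * (m + w)               ≡⟨ *-distribˡ-+ num m w ⟩
      num * m + num * w           ≤⟨ +-monoˡ-≤ (num * w) lo ⟩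
      den * A m + under + num * w ≡⟨ shift (den * A m) under (num * w) ⟩
      den * A m + num * w + under ≡⟨ cong (_+ under) eq ⟨
      den * A (m + w) + under     ∎)
    where
    open ≤-Reasoning
    eq : den * A (m + w) ≡ den * A m + num * w
    eq = trans (cong (den *_) (count-periodic (avoids? bs) (_∘ anyDivides-+⁻ bs∣w) (_∘ anyDivides-+⁺ bs∣w) m))
               (trans (*-distribˡ-+ den (A m) (A w)) (cong (den * A m +_) period))

  go : ∀ r l → r < w → Bounds (l * w + r)
  go r zero    r<w = All.lookup check (∈-upTo⁺ r<w)
  go r (suc l) r<w = subst Bounds (trans (shift (l * w) r w) (cong (_+ r) (+-comm (l * w) w)))
                          (step (l * w + r) (go r l r<w))

  bounds : ∀ m → Bounds m
  bounds m = subst Bounds (trans (+-comm (m / w * w) (m % w)) (sym (m≡m%n+[m/n]*n m w)))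
                   (go (m % w) (m / w) (m%n<n m w))

check? : ∀ bs w den num under over →
  Dec (All (λ m → den * count (avoids? bs) m ≤ num * m + over
                × num * m ≤ den * count (avoids? bs) m + under) (upTo w))
check? bs w den num under over =
  all? (λ m → (den * count (avoids? bs) m ≤? num * m + over)
        ×-dec (num * m ≤? den * count (avoids? bs) m + under)) (upTo w)

-- The densities 1, 1/2, 1/3, 4/15 and 8/35 are φ(w) / w for w = 1, 2, 6, 30 and 210. The last two
-- numerals in each call are the errors `under` and `over`.
density₁ density₂ density₆ density₃₀ density₂₁₀ : Density
density₁ = periodicDensity [] 1 1 1 0 0 (s≤s z≤n) (s≤s z≤n)
  (toWitness {a? = all? (_∣? 1) []} _) (toWitness {a? = check? [] 1 1 1 0 0} _) refl
density₂ = periodicDensity (2 ∷ []) 2 2 1 0 1 (s≤s z≤n) (s≤s z≤n)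
  (toWitness {a? = all? (_∣? 2) _} _) (toWitness {a? = check? (2 ∷ []) 2 2 1 0 1} _) refl
density₆ = periodicDensity (2 ∷ 3 ∷ []) 6 3 1 1 2 (s≤s z≤n) (s≤s z≤n)
  (toWitness {a? = all? (_∣? 6) _} _) (toWitness {a? = check? (2 ∷ 3 ∷ []) 6 3 1 1 2} _) refl
density₃₀ = periodicDensity (2 ∷ 3 ∷ 5 ∷ []) 30 15 4 10 14 (s≤s z≤n) (s≤s z≤n)
  (toWitness {a? = all? (_∣? 30) _} _) (toWitness {a? = check? (2 ∷ 3 ∷ 5 ∷ []) 30 15 4 10 14} _) refl
density₂₁₀ = periodicDensity (2 ∷ 3 ∷ 5 ∷ 7 ∷ []) 210 35 8 45 53 (s≤s z≤n) (s≤s z≤n)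
  (toWitness {a? = all? (_∣? 210) _} _)
  (toWitness {a? = check? (2 ∷ 3 ∷ 5 ∷ 7 ∷ []) 210 35 8 45 53} _) refl

-- Reciprocals are rounded up to multiples of 1 / K.
module Reciprocals (K : ℕ) where

  -- The maximum with 1 keeps clear of the junk value of `÷` at 0; the successor makes this an upper
  -- bound for `K` divided by `1 ⊔ r`.
  recip : ℕ → ℕ
  recip r = suc (K ÷ (1 ⊔ r))

  Σrecip : List ℕ → ℕ
  Σrecip rs = sum (map recip rs)

  K*÷≤ : ∀ x → r ≤ q → 1 ≤ q → K * (x ÷ q) ≤ x * recip r
  K*÷≤ {r} {q} x r≤q 1≤q = begin
    K * (x ÷ q)             ≤⟨ *-monoˡ-≤ (x ÷ q) (<⇒≤ (<-÷-* K (1 ⊔ r) (m≤m⊔n 1 r))) ⟩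
    recip r * (1 ⊔ r) * (x ÷ q) ≤⟨ *-monoˡ-≤ (x ÷ q) (*-monoʳ-≤ (recip r) (⊔-lub 1≤q r≤q)) ⟩
    recip r * q * (x ÷ q)   ≡⟨ eq (recip r) q (x ÷ q) ⟩
    x ÷ q * q * recip r     ≤⟨ *-monoˡ-≤ (recip r) (÷-*-≤ x q) ⟩
    x * recip r             ∎
    where
    open ≤-Reasoning
    eq : ∀ a b c → a * b * c ≡ c * b * a
    eq = solve-∀

  module _ (δ : Density) where
    open Density δ

    ΣA : ℕ → List ℕ → ℕ
    ΣA x qs = sum (map (λ q → A (x ÷ q)) qs)

    -- The upper density bound is applied to each `x ÷ q`, where 1 / q is at most `recip r` / `K`;
    -- every term contributes one error `over`. Denominators are cleared by `K * den`.
    ΣA-bound : ∀ x → Pointwise _≤_ rs qs → All (1 ≤_) qs →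
               K * (den * ΣA x qs) ≤ num * x * Σrecip rs + K * (over * length rs)
    ΣA-bound x [] [] = ≤-trans (≤-reflexive (trans (cong (K *_) (*-zeroʳ den)) (*-zeroʳ K))) z≤n
    ΣA-bound x (_∷_ {x = r} {y = q} {xs = rs} {ys = qs} r≤q rs≤qs) (1≤q ∷ 1≤qs) = begin
      K * (den * (A (x ÷ q) + ΣA x qs))
        ≡⟨ eq₁ K den (A (x ÷ q)) (ΣA x qs) ⟩
      K * (den * A (x ÷ q)) + K * (den * ΣA x qs)
        ≤⟨ +-mono-≤ (*-monoʳ-≤ K (upper (x ÷ q))) (ΣA-bound x rs≤qs 1≤qs) ⟩
      K * (num * (x ÷ q) + over) + (num * x * Σrecip rs + K * (over * length rs))
        ≡⟨ eq₂ K num (x ÷ q) over (num * x * Σrecip rs + K * (over * length rs)) ⟩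
      num * (K * (x ÷ q)) + (K * over + (num * x * Σrecip rs + K * (over * length rs)))
        ≤⟨ +-monoˡ-≤ _ (*-monoʳ-≤ num (K*÷≤ x r≤q 1≤q)) ⟩
      num * (x * recip r) + (K * over + (num * x * Σrecip rs + K * (over * length rs)))
        ≡⟨ eq₃ K num x over (recip r) (Σrecip rs) (length rs) ⟩
      num * x * (recip r + Σrecip rs) + K * (over * suc (length rs)) ∎
      where
      open ≤-Reasoning
      eq₁ : ∀ k d a b → k * (d * (a + b)) ≡ k * (d * a) + k * (d * b)
      eq₁ = solve-∀
      eq₂ : ∀ k n y o z → k * (n * y + o) + z ≡ n * (k * y) + (k * o + z)
      eq₂ = solve-∀
      eq₃ : ∀ k n x o r s t → n * (x * r) + (k * o + (n * x * s + k * (o * t)))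
                            ≡ n * x * (r + s) + k * (o * suc t)
      eq₃ = solve-∀

-- The inequality at `X` forces `u ≤ k`, so the right side grows at least as fast as the left. This
-- reduces an estimate for all large `x` to one numerical test at a threshold.
linear-grow : ∀ {c u k X x} → 1 ≤ X → X ≤ x → c + X * u ≤ k * X → c + x * u ≤ k * x
linear-grow {c} {u} {k} {X} {x} 1≤X X≤x h = begin
  c + x * u               ≡⟨ cong (λ z → c + z * u) x≡ ⟩
  c + (X + e) * u         ≡⟨ eq c X e u ⟩
  c + X * u + e * u       ≤⟨ +-mono-≤ h (*-monoʳ-≤ e u≤k) ⟩
  k * X + e * k           ≡⟨ eq′ k X e ⟩
  k * (X + e)             ≡⟨ cong (k *_) x≡ ⟨
  k * x                   ∎
  where
  open ≤-Reasoning
  e = x ∸ X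
  x≡ : x ≡ X + e
  x≡ = sym (m+[n∸m]≡n X≤x)
  eq : ∀ c X e u → c + (X + e) * u ≡ c + X * u + e * u
  eq = solve-∀
  eq′ : ∀ k X e → k * X + e * k ≡ k * (X + e)
  eq′ = solve-∀
  u≤k : u ≤ k
  u≤k = *-cancelˡ-≤ X {{>-nonZero 1≤X}} (≤-trans (m≤n+m (X * u) c) (≤-trans h (≤-reflexive (*-comm k X))))

-- Here f counts friends and s the class of P; S₁ and S₂ sum A (x ÷ r) over the
-- prime factors of N and over the sieving primes outside the base respectively.
sieve-estimate : ∀ {K D N a b t R σ ρ X x f s S₁ S₂ A} → 1 ≤ K → 1 ≤ D → 1 ≤ N → 1 ≤ X → X ≤ x →
  K * (b * (2 * t + R)) + K * a + N * X * (2 * σ + ρ) ≤ K * (N * X) →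
  K * (D * S₁) ≤ N * x * σ + K * (b * t) →
  K * (D * S₂) ≤ N * x * ρ + K * (b * R) →
  N * x ≤ D * A + a → A ≤ s + S₂ → f ≤ S₁ → 2 * f ≤ s
sieve-estimate {K} {D} {N} {a} {b} {t} {R} {σ} {ρ} {X} {x} {f} {s} {S₁} {S₂} {A}
  1≤K 1≤D 1≤N 1≤X X≤x test S₁≤ S₂≤ lower A≤ f≤ =
  *-cancelˡ-≤ (K * D) {{>-nonZero (*-mono-≤ 1≤K 1≤D)}} (+-cancelʳ-≤ (K * (D * S₂) + K * a) _ _ (begin
    K * D * (2 * f) + (K * (D * S₂) + K * a)
      ≤⟨ +-monoˡ-≤ _ (*-monoʳ-≤ (K * D) (*-monoʳ-≤ 2 f≤)) ⟩
    K * D * (2 * S₁) + (K * (D * S₂) + K * a)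
      ≡⟨ eq₁ K D S₁ _ ⟩
    2 * (K * (D * S₁)) + (K * (D * S₂) + K * a)
      ≤⟨ +-mono-≤ (*-monoʳ-≤ 2 S₁≤) (+-monoˡ-≤ (K * a) S₂≤) ⟩
    2 * (N * x * σ + K * (b * t)) + (N * x * ρ + K * (b * R) + K * a)
      ≡⟨ eq₂ N x σ (K * (b * R)) K b t ρ a R ⟩
    K * (b * (2 * t + R)) + K * a + N * x * (2 * σ + ρ)
      ≤⟨ linear-grow {c = K * (b * (2 * t + R)) + K * a} {u = 2 * σ + ρ} {k = K}
                     (*-mono-≤ 1≤N 1≤X) (*-monoʳ-≤ N X≤x) test ⟩
    K * (N * x)                         ≤⟨ *-monoʳ-≤ K lower ⟩
    K * (D * A + a)                     ≤⟨ *-monoʳ-≤ K (+-monoˡ-≤ a (*-monoʳ-≤ D A≤)) ⟩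
    K * (D * (s + S₂) + a)              ≡⟨ eq₃ K D s S₂ a ⟩
    K * D * s + (K * (D * S₂) + K * a)  ∎))
  where
  open ≤-Reasoning
  eq₁ : ∀ k d s z → k * d * (2 * s) + z ≡ 2 * (k * (d * s)) + z
  eq₁ = solve-∀
  eq₂ : ∀ n x σ y k b t ρ a r →
        2 * (n * x * σ + k * (b * t)) + (n * x * ρ + k * (b * r) + k * a)
        ≡ k * (b * (2 * t + r)) + k * a + n * x * (2 * σ + ρ)
  eq₂ = solve-∀
  eq₃ : ∀ k d s z a → k * (d * (s + z) + a) ≡ k * d * s + (k * (d * z) + k * a)
  eq₃ = solve-∀

-- The sieve test for the class of P

base : ℕ → Density
base 0 = density₁
base 1 = density₁
base 2 = density₁
base 3 = density₂
base 4 = density₆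
base 5 = density₆
base 6 = density₃₀
base 7 = density₃₀
base _ = density₂₁₀

extra? : ∀ P → Decidable (λ r → 7 < r × r < P)
extra? P r = (7 <? r) ×-dec (r <? P)

-- The sieving primes left over after `base P` has taken care of those up to 7.
extra : ℕ → List ℕ
extra P = filter (extra? P) primesTo541

sieve-bounds : ∀ P → All (λ r → 2 ≤ r × r < P) (Density.sieve (base P))
sieve-bounds 0 = []
sieve-bounds 1 = []
sieve-bounds 2 = []
sieve-bounds 3 = toWitness {a? = all? (λ r → (2 ≤? r) ×-dec (r <? 3)) _} _
sieve-bounds 4 = toWitness {a? = all? (λ r → (2 ≤? r) ×-dec (r <? 4)) _} _
sieve-bounds 5 = toWitness {a? = all? (λ r → (2 ≤? r) ×-dec (r <? 5)) _} _
sieve-bounds 6 = toWitness {a? = all? (λ r → (2 ≤? r) ×-dec (r <? 6)) _} _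
sieve-bounds 7 = toWitness {a? = all? (λ r → (2 ≤? r) ×-dec (r <? 7)) _} _
sieve-bounds P@(suc (suc (suc (suc (suc (suc (suc (suc _)))))))) =
  All.map (λ (2≤r , r<8) → 2≤r , ≤-trans r<8 (m≤m+n 8 _))
    (toWitness {a? = all? (λ r → (2 ≤? r) ×-dec (r <? 8)) (2 ∷ 3 ∷ 5 ∷ 7 ∷ [])} _)

smallPrimes : All (λ r → r ∈ 2 ∷ 3 ∷ 5 ∷ 7 ∷ [] ⊎ 7 < r) primesTo541
smallPrimes = toWitness {a? = all? (λ r → (r ∈? 2 ∷ 3 ∷ 5 ∷ 7 ∷ []) ⊎-dec (7 <? r)) primesTo541} _

sieve-complete : ∀ P → P ≤ 541 → Prime r → r < P → r ∈ Density.sieve (base P) ⊎ r ∈ extra P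
sieve-complete {r} P P≤541 r-prime r<P with prime⇒∈primesTo541 r-prime
... | inj₂ 541<r = contradiction (<-trans 541<r r<P) (≤⇒≯ P≤541)
... | inj₁ r∈ with All.lookup smallPrimes r∈
...   | inj₂ 7<r = inj₂ (∈-filter⁺ (extra? P) r∈ (7<r , r<P))
...   | inj₁ r∈2357 = inj₁ (small P r<P r∈2357)
  where
  pick : ∀ P {L : List ℕ} → All (λ r → r < P → r ∈ L) (2 ∷ 3 ∷ 5 ∷ 7 ∷ []) → r < P →
         r ∈ 2 ∷ 3 ∷ 5 ∷ 7 ∷ [] → r ∈ L
  pick P all r<P r∈2357 = All.lookup all r∈2357 r<P
  table? : ∀ P L → Dec (All (λ r → r < P → r ∈ L) (2 ∷ 3 ∷ 5 ∷ 7 ∷ []))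
  table? P L = all? (λ r → (r <? P) →-dec (r ∈? L)) _
  small : ∀ P → r < P → r ∈ 2 ∷ 3 ∷ 5 ∷ 7 ∷ [] → r ∈ Density.sieve (base P)
  small 0 = pick 0 (toWitness {a? = table? 0 []} _)
  small 1 = pick 1 (toWitness {a? = table? 1 []} _)
  small 2 = pick 2 (toWitness {a? = table? 2 []} _)
  small 3 = pick 3 (toWitness {a? = table? 3 (2 ∷ [])} _)
  small 4 = pick 4 (toWitness {a? = table? 4 (2 ∷ 3 ∷ [])} _)
  small 5 = pick 5 (toWitness {a? = table? 5 (2 ∷ 3 ∷ [])} _)
  small 6 = pick 6 (toWitness {a? = table? 6 (2 ∷ 3 ∷ 5 ∷ [])} _)
  small 7 = pick 7 (toWitness {a? = table? 7 (2 ∷ 3 ∷ 5 ∷ [])} _)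
  small (suc (suc (suc (suc (suc (suc (suc (suc _)))))))) r<P r∈2357 = r∈2357

rough⇒avoids : ∀ {bs} → All (λ r → 2 ≤ r × r < P) bs → P Rough k → ¬ AnyDivides bs k
rough⇒avoids bounds k-rough any with find any
... | r , r∈ , r∣k = let (2≤r , r<P) = All.lookup bounds r∈ in <⇒≱ r<P (rough⇒≥ k-rough 2≤r r∣k)

module SieveTest (K P : ℕ) where
  open Reciprocals K
  open Density (base P)

  -- A lower bound for `n ÷ P`: the first term comes from P³ ≤ n, the second from
  -- `product rs ≤ suc n`, where `pred` passes from `suc n` to `n`.
  threshold : List ℕ → ℕ
  threshold rs = P * P ⊔ (pred (product rs) ÷ P)

  -- The numerical hypothesis of `sieve-estimate`, with `X` the threshold and `rs` in place of the
  -- unknown prime factors.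
  sieveTest : List ℕ → Bool
  sieveTest rs =
    K * (over * (2 * length rs + length (extra P))) + K * under + num * X * (2 * Σrecip rs + Σrecip (extra P))
      ≤ᵇ K * (num * X)
    where X = threshold rs

  sieveTest-sound : ∀ {x} → 1 ≤ K → Prime P → P ≤ 541 → Pointwise _≤_ rs qs → All (1 ≤_) qs →
    T (sieveTest rs) → threshold rs ≤ x →
    2 * count ((P rough?_) ∩? anyDivides? qs) x ≤ count (P rough?_) x
  sieveTest-sound {rs} {qs} {x} 1≤K P-prime P≤541 rs≤qs 1≤qs ok X≤x =
    sieve-estimate {K} {den} {num} {under} {over} {length rs} {length (extra P)} {Σrecip rs} {Σrecip (extra P)}
      1≤K 1≤den 1≤num
      (≤-trans (*-mono-≤ (prime⇒1≤ P-prime) (prime⇒1≤ P-prime)) (m≤m⊔n (P * P) _)) X≤x (≤ᵇ⇒≤ _ _ ok)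
      (ΣA-bound (base P) x rs≤qs 1≤qs) (ΣA-bound (base P) x (Pointwise-refl ≤-refl) 1≤extra)
      (lower x) A≤ friends≤
    where
    1≤extra : All (1 ≤_) (extra P)
    1≤extra = All.tabulate λ r∈ → ≤-trans (s≤s z≤n) (proj₁ (proj₂ (∈-filter⁻ (extra? P) {xs = primesTo541} r∈)))

    friends≤ : count ((P rough?_) ∩? anyDivides? qs) x ≤ ΣA (base P) x qs
    friends≤ = count-anyDivides x (P rough?_) (avoids? sieve) qs 1≤qs λ q ql-rough →
      rough⇒avoids (sieve-bounds P) (rough∧∣⇒rough ql-rough (n∣m*n q))

    sieved : ∀ {k} → ¬ AnyDivides sieve k → P Rough k ⊎ ¬ AnyDivides sieve k × AnyDivides (extra P) k
    sieved {k} avoids with anyDivides? (extra P) k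
    ... | yes any = inj₂ (avoids , any)
    ... | no ¬any = inj₁ (∤⇒rough λ r-prime r<P r∣k →
      [ (λ r∈ → avoids (lose r∈ r∣k)) , (λ r∈ → ¬any (lose r∈ r∣k)) ]′ (sieve-complete P P≤541 r-prime r<P))

    -- What survives the base sieve is `P`-rough or a multiple of a prime in `extra P`; in the
    -- second case the cofactor survives the base sieve as well, so it is counted by `A` again.
    A≤ : A x ≤ count (P rough?_) x + ΣA (base P) x (extra P)
    A≤ = ≤-trans (count-∪ x (avoids? sieve) (P rough?_) (avoids? sieve ∩? anyDivides? (extra P)) λ _ _ → sieved)
      (+-monoʳ-≤ _ (count-anyDivides x (avoids? sieve) (avoids? sieve) (extra P) 1≤extra
         λ q avoids → avoids ∘ anyDivides-*⁺ q))

-- The precision of the reciprocals is 10⁻⁶. The scan starts above both `P` and 5, because every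
-- prime factor of N exceeds `P` and the cases q ≤ 5 are treated separately.
SieveChecked : ℕ → Set
SieveChecked P = T ((n₀ ≤ᵇ P * P * P) ∨ scan (SieveTest.sieveTest 1000000 P) n₀ 1 (primesAbove (5 ⊔ P)))

sieveChecked : All SieveChecked primesTo541
sieveChecked = toWitness {a? = all? (λ P →
  T? ((n₀ ≤ᵇ P * P * P) ∨ scan (SieveTest.sieveTest 1000000 P) n₀ 1 (primesAbove (5 ⊔ P)))) primesTo541} _

-- Totatives below N / 2

-- Euler's φ of a product of distinct primes. If `qs` are the distinct prime factors of N, then
-- `totient qs` over `product qs` is φ(N) / N.
totient : List ℕ → ℕ
totient = product ∘ map pred

-- Each factor (r - 1) / r increases with r, so termwise smaller entries give a smaller ratio of
-- totient to product.
totient-mono : Pointwise _≤_ rs qs → totient rs * product qs ≤ totient qs * product rs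
totient-mono [] = ≤-refl
totient-mono (_∷_ {x = r} {y = q} {xs = rs} {ys = qs} r≤q rs≤qs) = begin
  pred r * totient rs * (q * product qs) ≡⟨ eq (pred r) (totient rs) q (product qs) ⟩
  pred r * q * (totient rs * product qs) ≤⟨ *-mono-≤ (lemma r q r≤q) (totient-mono rs≤qs) ⟩
  pred q * r * (totient qs * product rs) ≡⟨ eq (pred q) (totient qs) r (product rs) ⟨
  pred q * totient qs * (r * product rs) ∎
  where
  open ≤-Reasoning
  eq : ∀ a b c d → a * b * (c * d) ≡ a * c * (b * d)
  eq = solve-∀
  lemma : ∀ r q → r ≤ q → pred r * q ≤ pred q * r
  lemma zero    q       _         = z≤n
  lemma (suc r) (suc q) (s≤s r≤q) = begin
    r * suc q ≡⟨ *-suc r q ⟩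
    r + r * q ≤⟨ +-monoˡ-≤ (r * q) r≤q ⟩
    q + r * q ≡⟨ cong (q +_) (*-comm r q) ⟩
    q + q * r ≡⟨ *-suc q r ⟨
    q * suc r ∎

isEmpty : List ℕ → ℕ
isEmpty []      = 1
isEmpty (_ ∷ _) = 0

-- For qs ≠ [] this says that half of the totatives of N = 2 * M + 1 are ≤ M;
-- the correction term for qs = [] makes Legendre's recursion apply.
legendre : ∀ qs M → AllPairs _<_ qs → All Prime qs → product qs ∣ suc (2 * M) →
           (2 * count (avoids? qs) M + isEmpty qs) * product qs ≡ suc (2 * M) * totient qs
legendre [] M [] [] _ = cong (_* 1) (trans (cong (λ c → 2 * c + 1) (all-counted M)) (+-comm (2 * M) 1))
  where
  all-counted : ∀ M → count (avoids? []) M ≡ M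
  all-counted zero    = refl
  all-counted (suc M) = cong₂ _+_ (⟦⟧-yes (avoids? [] (suc M)) λ ()) (all-counted M)
legendre (q ∷ qs) M (q<qs ∷ sorted) (q-prime ∷ primes) (divides c N≡) =
  finish q (product qs) (totient qs) (isEmpty qs) (count (avoids? (q ∷ qs)) M) (count (avoids? qs) M)
         (count (avoids? qs) M′) (c * product qs) (suc (2 * M)) q≥1 N≡qm split
         (legendre qs M sorted primes (∣-trans (n∣m*n q) (divides c N≡)))
         (subst (λ m → (2 * count (avoids? qs) M′ + isEmpty qs) * product qs ≡ m * totient qs) (sym m≡)
            (legendre qs M′ sorted primes (subst (product qs ∣_) m≡ (n∣m*n c))))
  where
  q≥1 : 1 ≤ q
  q≥1 = prime⇒1≤ q-prime
  M′ : ℕ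
  M′ = M ÷ q

  N≡qm : suc (2 * M) ≡ q * (c * product qs)
  N≡qm = trans N≡ (eq c q (product qs))
    where
    eq : ∀ c q p → c * (q * p) ≡ q * (c * p)
    eq = solve-∀

  odd : ∀ m → suc (2 * M) ≡ q * m → ∃ λ h → m ≡ suc (2 * h)
  odd m eq = half m λ { (divides h refl) → 2∤odd (divides (q * h) (trans eq (sym (*-assoc q h 2)))) }
    where
    2∤odd : ¬ 2 ∣ suc (2 * M)
    2∤odd 2∣ = contradiction (∣1⇒≡1 (∣m+n∣m⇒∣n (subst (2 ∣_) (+-comm 1 (2 * M)) 2∣) (m∣m*n M))) λ ()
    half : ∀ m → ¬ 2 ∣ m → ∃ λ h → m ≡ suc (2 * h)
    half zero          2∤m = contradiction (2 ∣0) 2∤m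
    half (suc zero)    2∤m = 0 , refl
    half (suc (suc m)) 2∤m with half m (λ 2∣m → 2∤m (∣m∣n⇒∣m+n ∣-refl 2∣m))
    ... | h , refl = suc h , cong suc (sym (*-suc 2 h))

  -- The cofactor m of `q` in the odd number N = 2M + 1 is odd too, and `M ÷ q` is exactly (m - 1) /
  -- 2. Hence the induction hypothesis applies both to N and to m.
  m≡ : c * product qs ≡ suc (2 * M′)
  m≡ with odd (c * product qs) N≡qm
  ... | h , m≡1+2h = trans m≡1+2h (cong (λ h → suc (2 * h)) (sym (÷-≡ {h} q≥1 lo hi)))
    where
    open ≤-Reasoning
    N≡q[1+2h] : suc (2 * M) ≡ q * suc (2 * h)
    N≡q[1+2h] = trans N≡qm (cong (q *_) m≡1+2h)
    lo : h * q ≤ M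
    lo = ≤-pred (*-cancelˡ-< 2 (h * q) (suc M) (begin-strict
      2 * (h * q)       ≡⟨ eq₁ h q ⟩
      q * (2 * h)       ≤⟨ *-monoʳ-≤ q (n≤1+n (2 * h)) ⟩
      q * suc (2 * h)   ≡⟨ N≡q[1+2h] ⟨
      suc (2 * M)       <⟨ n<1+n _ ⟩
      suc (suc (2 * M)) ≡⟨ *-suc 2 M ⟨
      2 * suc M         ∎))
      where
      eq₁ : ∀ h q → 2 * (h * q) ≡ q * (2 * h)
      eq₁ = solve-∀
    hi : M < suc h * q
    hi = *-cancelˡ-< 2 M (suc h * q) (begin-strict
      2 * M             <⟨ n<1+n _ ⟩
      suc (2 * M)       ≡⟨ N≡q[1+2h] ⟩
      q * suc (2 * h)   ≤⟨ *-monoʳ-≤ q (n≤1+n (suc (2 * h))) ⟩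
      q * suc (suc (2 * h)) ≡⟨ eq₂ h q ⟩
      2 * (suc h * q)   ∎)
      where
      eq₂ : ∀ h q → q * suc (suc (2 * h)) ≡ 2 * (suc h * q)
      eq₂ = solve-∀

  qs∤q : All (λ r → ¬ r ∣ q) qs
  qs∤q = All.zipWith (λ (q<r , _) r∣q → <⇒≱ q<r (∣⇒≤ {{>-nonZero q≥1}} r∣q)) (q<qs , primes)

  split : count (avoids? qs) M ≡ count (avoids? qs) M′ + count (avoids? (q ∷ qs)) M
  split = begin
    count (avoids? qs) M
      ≡⟨ count-split M (avoids? qs) (q ∣?_) ⟩
    count (avoids? qs ∩? (q ∣?_)) M + count (avoids? qs ∩? ∁? (q ∣?_)) M
      ≡⟨ cong₂ _+_
          (trans (count-cong M (avoids? qs ∩? (q ∣?_)) ((q ∣?_) ∩? avoids? qs) (λ _ _ (a , b) → b , a) (λ _ _ (a , b) → b , a))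
          (trans (count-multiples M (avoids? qs) q≥1)
                 (count-cong M′ (λ l → avoids? qs (q * l)) (avoids? qs)
                    (λ _ _ a → a ∘ anyDivides-*⁺ q) (λ _ _ a → a ∘ anyDivides-*⁻ q-prime primes qs∤q))))
          (count-cong M (avoids? qs ∩? ∁? (q ∣?_)) (avoids? (q ∷ qs))
             (λ { _ _ (a , b) (here c) → b c ; _ _ (a , b) (there c) → a c }) (λ _ _ a → a ∘ there , a ∘ here)) ⟩
    count (avoids? qs) M′ + count (avoids? (q ∷ qs)) M ∎
    where open ≡-Reasoning

  -- The two instances of the induction hypothesis are subtracted. Their correction terms `e`
  -- cancel, which leaves correction 0 for the nonempty list.
  finish : ∀ q Π Φ e c₁ c₀ c′ m n → 1 ≤ q → n ≡ q * m → c₀ ≡ c′ + c₁ →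
           (2 * c₀ + e) * Π ≡ n * Φ → (2 * c′ + e) * Π ≡ m * Φ →
           (2 * c₁ + 0) * (q * Π) ≡ n * (pred q * Φ)
  finish (suc q) Π Φ e c₁ c₀ c′ m n _ refl refl h₀ h′ = +-cancelˡ-≡ (m * Φ * suc q) _ _ (begin
    m * Φ * suc q + (2 * c₁ + 0) * (suc q * Π)         ≡⟨ cong (λ z → z * suc q + (2 * c₁ + 0) * (suc q * Π)) h′ ⟨
    (2 * c′ + e) * Π * suc q + (2 * c₁ + 0) * (suc q * Π) ≡⟨ eq₁ c′ e Π q c₁ ⟩
    (2 * (c′ + c₁) + e) * Π * suc q                    ≡⟨ cong (_* suc q) h₀ ⟩
    suc q * m * Φ * suc q                              ≡⟨ eq₂ q m Φ ⟩
    m * Φ * suc q + suc q * m * (q * Φ)                ∎)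
    where
    open ≡-Reasoning
    eq₁ : ∀ c′ e Π q c₁ → (2 * c′ + e) * Π * suc q + (2 * c₁ + 0) * (suc q * Π) ≡ (2 * (c′ + c₁) + e) * Π * suc q
    eq₁ = solve-∀
    eq₂ : ∀ q m Φ → suc q * m * Φ * suc q ≡ m * Φ * suc q + suc q * m * (q * Φ)
    eq₂ = solve-∀

÷-monoˡ : ∀ {m n} d → m ≤ n → m ÷ d ≤ n ÷ d
÷-monoˡ zero    _   = z≤n
÷-monoˡ {m} (suc d) m≤n = ≤-÷ (s≤s z≤n) (≤-trans (÷-*-≤ m (suc d)) m≤n)

-- As `n` is one less than a multiple of `q`, the floor `n ÷ q` is one less than the cofactor.
∣suc⇒≡ : 1 ≤ q → q ∣ suc n → suc n ≡ suc (n ÷ q) * q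
∣suc⇒≡ {q} {n} 1≤q (divides (suc c) eq) = trans eq (cong (λ c → suc c * q)
  (sym (÷-≡ {c} 1≤q (≤-pred (≤-trans (+-monoˡ-≤ (c * q) 1≤q) (≤-reflexive (sym eq)))) (≤-reflexive eq))))

count-pos : ∀ m → 1 ≤ m → 1 ≤ count (P rough?_) m
count-pos {P} m 1≤m = ≤-trans (count-< {m = 0} (P rough?_) (s≤s z≤n) (rough-1 P)) (count-monoʳ (P rough?_) 1≤m)

-- A number above 1 and below `P` is a forbidden divisor of itself, so only 1 is counted.
count-rough-< : ∀ m → m < P → count (P rough?_) m ≤ 1
count-rough-< zero          _   = z≤n
count-rough-< {P} (suc zero) _  = +-mono-≤ (⟦⟧≤1 (P rough? 1)) z≤n
count-rough-< {P} (suc (suc m)) m<P = ≤-trans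
  (≤-reflexive (cong (_+ count (P rough?_) (suc m)) (⟦⟧-no (P rough? suc (suc m))
     λ m-rough → <⇒≱ m<P (rough⇒≥ m-rough (s≤s (s≤s z≤n)) ∣-refl))))
  (count-rough-< (suc m) (<-trans (n<1+n _) m<P))

pointwise-product : Pointwise _≤_ rs qs → product rs ≤ product qs
pointwise-product []             = ≤-refl
pointwise-product (r≤q ∷ rs≤qs) = *-mono-≤ r≤q (pointwise-product rs≤qs)

totient-bound : ∀ {a b} → Pointwise _≤_ rs qs → All (1 ≤_) qs →
                a * product rs < b * totient rs → a * product qs < b * totient qs
totient-bound {rs} {qs} {a} {b} rs≤qs 1≤qs h = *-cancelʳ-< (product rs) _ _ (begin-strict
  a * product qs * product rs   ≡⟨ eq a (product qs) (product rs) ⟩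
  a * product rs * product qs   <⟨ *-monoˡ-< (product qs) {{product≢0 (All.map (λ 1≤q → >-nonZero 1≤q) 1≤qs)}} h ⟩
  b * totient rs * product qs   ≡⟨ *-assoc b (totient rs) (product qs) ⟩
  b * (totient rs * product qs) ≤⟨ *-monoʳ-≤ b (totient-mono rs≤qs) ⟩
  b * (totient qs * product rs) ≡⟨ *-assoc b (totient qs) (product rs) ⟨
  b * totient qs * product rs   ∎)
  where
  open ≤-Reasoning
  eq : ∀ a b c → a * b * c ≡ a * c * b
  eq = solve-∀

-- No number lies strictly between 7 and `P` when `P ≤ 8`, so `extra P` is empty and the base sieve
-- is exact.
avoids⇒rough : ∀ {k} → P ≤ 8 → ¬ AnyDivides (Density.sieve (base P)) k → P Rough k
avoids⇒rough {P} P≤8 avoids = ∤⇒rough λ r-prime r<P r∣k →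
  [ (λ r∈ → avoids (lose r∈ r∣k))
  , (λ r∈ → let (7<r , _) = proj₂ (∈-filter⁻ (extra? P) {xs = primesTo541} r∈) in
            <⇒≱ (≤-<-trans 7<r r<P) P≤8) ]′
  (sieve-complete P (≤-trans P≤8 (m≤m+n 8 533)) r-prime r<P)

A≤rough : P ≤ 8 → ∀ m → Density.A (base P) m ≤ count (P rough?_) m
A≤rough {P} P≤8 m = count-mono m (avoids? (Density.sieve (base P))) (P rough?_) λ _ _ → avoids⇒rough P≤8

rough≤A : ∀ P m → count (P rough?_) m ≤ Density.A (base P) m
rough≤A P m = count-mono m (P rough?_) (avoids? (Density.sieve (base P))) λ _ _ → rough⇒avoids (sieve-bounds P)

-- Bounds for φ(N) / N that make the class of 2 lose: 1/3 if q = 3, and 11/25 if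
-- q = 5, since then the class of 5 has about N / 15 members.
test₃ test₅ : List ℕ → Bool
test₃ rs = 1 * product rs <ᵇ 3 * totient rs
test₅ rs = 11 * product rs <ᵇ 25 * totient rs

-- The class of 3 when the least prime factor is 5

module ThreeFive (K : ℕ) where
  open Reciprocals K

  threshold₃₅ : List ℕ → ℕ
  threshold₃₅ rs = 8 ⊔ (pred (product rs) ÷ 3)

  -- For x = n ÷ 3 and y = n ÷ 5 the class of 3 has at least x / 2 members and the class of 5 at
  -- least (y - 1) / 3, while 3x ≤ 5y + 4; together this is at least (21x - 18) / 30. Twice the
  -- number of friends is at most x times the sum of reciprocals plus `length rs`. The test compares
  -- the two after multiplication by 30 K.
  test₃₅ : List ℕ → Bool
  test₃₅ rs = suc (30 * K * length rs + 18 * K) + threshold₃₅ rs * (30 * Σrecip rs) ≤ᵇ 21 * K * threshold₃₅ rs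

  test₃₅-sound : ∀ {x y f s₃ s} → 1 ≤ K → T (test₃₅ rs) → threshold₃₅ rs ≤ x →
    Pointwise _≤_ rs qs → All (1 ≤_) qs → f ≤ ΣA density₂ x qs →
    x ≤ 2 * s₃ → y ≤ 3 * s + 1 → x * 3 ≤ 5 * y + 4 → 2 * f < s₃ + s
  test₃₅-sound {rs} {qs} {x} {y} {f} {s₃} {s} 1≤K ok X≤x rs≤qs 1≤qs f≤ x≤ y≤ 3x≤ =
    *-cancelˡ-< (30 * K) (2 * f) (s₃ + s) (+-cancelʳ-< (18 * K) _ _ (begin-strict
      30 * K * (2 * f) + 18 * K
        ≤⟨ +-monoˡ-≤ (18 * K) (*-monoʳ-≤ (30 * K) (*-monoʳ-≤ 2 f≤)) ⟩
      30 * K * (2 * ΣA density₂ x qs) + 18 * K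
        ≡⟨ eq₁ K (ΣA density₂ x qs) ⟩
      30 * (K * (2 * ΣA density₂ x qs)) + 18 * K
        ≤⟨ +-monoˡ-≤ (18 * K) (*-monoʳ-≤ 30 (ΣA-bound density₂ x rs≤qs 1≤qs)) ⟩
      30 * (1 * x * Σrecip rs + K * (1 * length rs)) + 18 * K
        ≡⟨ eq₂ K x (Σrecip rs) (length rs) ⟩
      30 * K * length rs + 18 * K + x * (30 * Σrecip rs)
        <⟨ linear-grow {suc (30 * K * length rs + 18 * K)} {30 * Σrecip rs} {21 * K} {threshold₃₅ rs} {x}
             (≤-trans (s≤s z≤n) (m≤m⊔n 8 (pred (product rs) ÷ 3))) X≤x (≤ᵇ⇒≤ _ _ ok) ⟩
      21 * K * x
        ≡⟨ eq₃ K x ⟩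
      15 * K * x + 2 * K * (x * 3)
        ≤⟨ +-mono-≤ (*-monoʳ-≤ (15 * K) x≤) (*-monoʳ-≤ (2 * K) 3x≤) ⟩
      15 * K * (2 * s₃) + 2 * K * (5 * y + 4)
        ≤⟨ +-monoʳ-≤ (15 * K * (2 * s₃)) (*-monoʳ-≤ (2 * K) (+-monoˡ-≤ 4 (*-monoʳ-≤ 5 y≤))) ⟩
      15 * K * (2 * s₃) + 2 * K * (5 * (3 * s + 1) + 4)
        ≡⟨ eq₄ K s₃ s ⟩
      30 * K * (s₃ + s) + 18 * K ∎))
    where
    open ≤-Reasoning
    eq₁ : ∀ K S → 30 * K * (2 * S) + 18 * K ≡ 30 * (K * (2 * S)) + 18 * K
    eq₁ = solve-∀
    eq₂ : ∀ K x σ t → 30 * (1 * x * σ + K * (1 * t)) + 18 * K ≡ 30 * K * t + 18 * K + x * (30 * σ)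
    eq₂ = solve-∀
    eq₃ : ∀ K x → 21 * K * x ≡ 15 * K * x + 2 * K * (x * 3)
    eq₃ = solve-∀
    eq₄ : ∀ K s₃ s → 15 * K * (2 * s₃) + 2 * K * (5 * (3 * s + 1) + 4) ≡ 30 * K * (s₃ + s) + 18 * K
    eq₄ = solve-∀

-- The longest prefix with product below `n₀` is 3, 5, ..., 19, where the ratio is still about
-- 0.342. The next prime 23 would bring it to about 0.327, below 1/3, but also completes `n₀`.
checked₃ : T (scan test₃ n₀ 1 (primesAbove 2))
checked₃ = tt

checked₅ : T (scan test₅ n₀ 1 (primesAbove 4))
checked₅ = tt

checked₃₅ : T (scan (ThreeFive.test₃₅ 1000000) n₀ 1 (primesAbove 4))
checked₃₅ = tt

-- Here suc n is composite with least prime factor q, and the class of a prime P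
-- among 1, …, n consists of the products P * k with k ≤ n ÷ P and P Rough k.
module Tally (n : ℕ) {qs : List ℕ} (supp : Support (suc n) qs)
         {q : ℕ} (q-prime : Prime q) (q∣N : q ∣ suc n) (N-rough : q Rough suc n) (N≢q : suc n ≢ q)
         where
  open Support supp

  friendCount enemyCount size : ℕ → ℕ
  friendCount P = count ((P rough?_) ∩? anyDivides? qs) (n ÷ P)
  enemyCount  P = count ((P rough?_) ∩? avoids? qs) (n ÷ P)
  size        P = count (P rough?_) (n ÷ P)

  size≡ : ∀ P → size P ≡ friendCount P + enemyCount P
  size≡ P = count-split (n ÷ P) (P rough?_) (anyDivides? qs)

  1≤qs : All (1 ≤_) qs
  1≤qs = All.map prime⇒1≤ primes

  q≤qs : All (q ≤_) qs
  q≤qs = All.zipWith (λ (r-prime , r∣N) → rough⇒≥ N-rough (prime⇒2≤ r-prime) r∣N) (primes , divide)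

  product≤ : product qs ≤ suc n
  product≤ = ∣⇒≤ (product-∣ sorted primes divide)

  y = n ÷ q

  N≡ : suc n ≡ suc y * q
  N≡ = ∣suc⇒≡ (prime⇒1≤ q-prime) q∣N

  1≤y : 1 ≤ y
  1≤y = n≢0⇒n>0 λ y≡0 → N≢q (trans N≡ (trans (cong (λ y → suc y * q) y≡0) (*-identityˡ q)))

  q≤1+y : q ≤ suc y
  q≤1+y = rough⇒≥ N-rough (s≤s 1≤y) (divides q (trans N≡ (*-comm (suc y) q)))

  1≤size : 1 ≤ size q
  1≤size = count-pos y 1≤y

  -- Relative to opening a new class, joining the class of `P` saves `friendCount P` conflicts and
  -- creates `enemyCount P`, whereas joining the class of `q` saves `size q` and creates none.
  Wins : ℕ → Set
  Wins P = friendCount P < enemyCount P + size q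

  wins : ∀ P → 2 * friendCount P < size P + size q → Wins P
  wins P h = +-cancelˡ-< (friendCount P) _ _ (begin-strict
    friendCount P + friendCount P               ≡⟨ cong (friendCount P +_) (+-identityʳ _) ⟨
    2 * friendCount P                           <⟨ h ⟩
    size P + size q                             ≡⟨ cong (_+ size q) (size≡ P) ⟩
    friendCount P + enemyCount P + size q       ≡⟨ +-assoc (friendCount P) _ _ ⟩
    friendCount P + (enemyCount P + size q)     ∎)
    where open ≤-Reasoning

  module _ {P : ℕ} (P-prime : Prime P) (P<q : P < q) where

    P∤N : ¬ P ∣ suc n
    P∤N = rough⇒∤ N-rough P-prime P<q

    -- Below P³ the integer suc n is a product of two primes, so that it has at most
    -- two friends k = q and k = suc n / q.
    wins-small : suc n < P * P * P → Wins P
    wins-small N<P³ = begin-strict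
      friendCount P
        ≤⟨ count-mono (n ÷ P) ((P rough?_) ∩? anyDivides? qs) ((P rough?_) ∩? anyDivides? (q ∷ suc y ∷ []))
             (λ _ _ (k-rough , any) → k-rough , twoPrimes any) ⟩
      count ((P rough?_) ∩? anyDivides? (q ∷ suc y ∷ [])) (n ÷ P)
        ≤⟨ count-anyDivides (n ÷ P) (P rough?_) (P rough?_) (q ∷ suc y ∷ [])
             (prime⇒1≤ q-prime ∷ s≤s z≤n ∷ []) (λ r rl-rough → rough∧∣⇒rough rl-rough (n∣m*n r)) ⟩
      count (P rough?_) (n ÷ P ÷ q) + (count (P rough?_) (n ÷ P ÷ suc y) + 0)
        ≤⟨ +-mono-≤ (one q ≤-refl) (+-monoˡ-≤ 0 (one (suc y) q≤1+y)) ⟩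
      2                      <⟨ n<1+n 2 ⟩
      2 + 1                  ≤⟨ +-mono-≤ 2≤enemyCount 1≤size ⟩
      enemyCount P + size q  ∎
      where
      open ≤-Reasoning
      1≤P = prime⇒1≤ P-prime
      x<P² : n ÷ P < P * P
      x<P² = *-cancelʳ-< P (n ÷ P) (P * P) (≤-<-trans (÷-*-≤ n P) (<-trans (n<1+n n) N<P³))
      -- Since `n ÷ P` is below P² and `r` exceeds `P`, the cofactors of `r` are below `P`, where
      -- only 1 is rough.
      one : ∀ r → q ≤ r → count (P rough?_) (n ÷ P ÷ r) ≤ 1
      one r q≤r = count-rough-< (n ÷ P ÷ r) (*-cancelʳ-< P _ _ (≤-<-trans
        (*-monoʳ-≤ (n ÷ P ÷ r) (<⇒≤ (<-≤-trans P<q q≤r))) (≤-<-trans (÷-*-≤ (n ÷ P) r) x<P²)))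
      1+y<P² : suc y < P * P
      1+y<P² = *-cancelʳ-< P (suc y) (P * P) (≤-<-trans (*-monoʳ-≤ (suc y) (<⇒≤ P<q))
                 (≤-<-trans (≤-reflexive (sym N≡)) N<P³))
      -- The cofactor N / q is `q`-rough and smaller than P² ≤ q², which leaves no room for two
      -- prime factors.
      1+y-prime : Prime (suc y)
      1+y-prime = rough∧square>⇒prime {{n>1⇒nonTrivial (s≤s 1≤y)}}
        (rough∧∣⇒rough N-rough (divides q (trans N≡ (*-comm (suc y) q))))
        (<-≤-trans 1+y<P² (*-mono-≤ (<⇒≤ P<q) (<⇒≤ P<q)))
      twoPrimes : ∀ {k} → AnyDivides qs k → AnyDivides (q ∷ suc y ∷ []) k
      twoPrimes {k} any with find any
      ... | r , r∈ , r∣k with euclidsLemma (suc y) q (All.lookup primes r∈) (subst (r ∣_) N≡ (All.lookup divide r∈))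
      ...   | inj₁ r∣1+y = there (here (subst (_∣ k) (prime-∣-prime (All.lookup primes r∈) 1+y-prime r∣1+y) r∣k))
      ...   | inj₂ r∣q   = here (subst (_∣ k) (prime-∣-prime (All.lookup primes r∈) q-prime r∣q) r∣k)
      P≤x : P ≤ n ÷ P
      P≤x = ≤-÷ 1≤P (≤-pred (≤-trans (*-mono-< P<q P<q) (≤-trans (*-monoˡ-≤ q q≤1+y) (≤-reflexive (sym N≡)))))
      enemy₁ : P Rough 1 × ¬ AnyDivides qs 1
      enemy₁ = rough-1 P , λ any → let (r , r∈ , r∣1) = find any in
        <⇒≢ (prime⇒2≤ (All.lookup primes r∈)) (sym (∣1⇒≡1 r∣1))
      enemyₚ : P Rough P × ¬ AnyDivides qs P
      enemyₚ = prime⇒rough P-prime , λ any → let (r , r∈ , r∣P) = find any in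
        P∤N (subst (_∣ suc n) (prime-∣-prime (All.lookup primes r∈) P-prime r∣P) (All.lookup divide r∈))
      2≤enemyCount : 2 ≤ enemyCount P
      2≤enemyCount = ≤-trans (s≤s (count-< E? (s≤s z≤n) enemy₁))
        (≤-trans (count-< E? (prime⇒2≤ P-prime) enemyₚ) (count-monoʳ E? P≤x))
        where E? = (P rough?_) ∩? avoids? qs

  module _ (q≡5 : q ≡ 5) where
    n≡ : n ≡ 5 * y + 4
    n≡ = suc-injective (trans N≡ (trans (cong (suc y *_) q≡5) (eq y)))
      where
      eq : ∀ y → suc y * 5 ≡ suc (5 * y + 4)
      eq = solve-∀

    4≤y : 4 ≤ y
    4≤y = ≤-pred (subst (_≤ suc y) q≡5 q≤1+y)

    y≤₅ : y ≤ 3 * size q + 1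
    y≤₅ = begin
      y                               ≡⟨ *-identityˡ y ⟨
      1 * y                           ≤⟨ Density.lower density₆ y ⟩
      3 * Density.A density₆ y + 1    ≤⟨ +-monoˡ-≤ 1 (*-monoʳ-≤ 3 (A≤rough {5} (m≤m+n 5 3) y)) ⟩
      3 * count (5 rough?_) y + 1     ≡⟨ cong (λ q → 3 * count (q rough?_) y + 1) q≡5 ⟨
      3 * size q + 1                  ∎
      where open ≤-Reasoning

  -- The class of 2 for odd N

  module _ (2<q : 2 < q) where

    M c : ℕ
    M = n ÷ 2
    c = count (avoids? qs) M

    2∤N : ¬ 2 ∣ suc n
    2∤N = rough⇒∤ N-rough prime[2] 2<q

    n≡2M : n ≡ 2 * M
    n≡2M with m≤n⇒m<n∨m≡n (÷-*-≤ n 2)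
    ... | inj₂ M*2≡n = trans (sym M*2≡n) (*-comm M 2)
    ... | inj₁ M*2<n = contradiction
            (divides (suc M) (cong suc (≤-antisym (≤-pred (<-÷-* n 2 (s≤s z≤n))) M*2<n))) 2∤N

    enemyCount≡ : enemyCount 2 ≡ c
    enemyCount≡ = count-cong M ((2 rough?_) ∩? avoids? qs) (avoids? qs) (λ _ _ → proj₂) (λ _ _ a → 2-rough , a)

    size≡M : size 2 ≡ M
    size≡M = all-counted M
      where
      all-counted : ∀ m → count (2 rough?_) m ≡ m
      all-counted zero    = refl
      all-counted (suc m) = cong₂ _+_ (⟦⟧-yes (2 rough? suc m) 2-rough) (all-counted m)

    friends+c≡M : friendCount 2 + c ≡ M
    friends+c≡M = trans (cong (friendCount 2 +_) (sym enemyCount≡)) (trans (sym (size≡ 2)) size≡M)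

    -- This is 2 c = φ(N) with the denominator cleared. The correction in `legendre` vanishes
    -- because `q` is an entry of `qs`.
    half-totient : 2 * c * product qs ≡ suc n * totient qs
    half-totient = begin
      2 * c * product qs                ≡⟨ cong (_* product qs) (+-identityʳ (2 * c)) ⟨
      (2 * c + 0) * product qs          ≡⟨ cong (λ e → (2 * c + e) * product qs) (nonempty (complete q-prime q∣N)) ⟨
      (2 * c + isEmpty qs) * product qs
        ≡⟨ legendre qs M sorted primes (subst (λ n → product qs ∣ suc n) n≡2M (product-∣ sorted primes divide)) ⟩
      suc (2 * M) * totient qs          ≡⟨ cong (λ n → suc n * totient qs) n≡2M ⟨
      suc n * totient qs                ∎
      where
      open ≡-Reasoning
      nonempty : ∀ {qs} → q ∈ qs → isEmpty qs ≡ 0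
      nonempty (here _)  = refl
      nonempty (there _) = refl

    private
      move₁ : ∀ a N Π → a * N * Π ≡ N * (a * Π)
      move₁ = solve-∀
      move₂ : ∀ b N Φ → N * (b * Φ) ≡ b * (N * Φ)
      move₂ = solve-∀

    totient> : ∀ {a b} → a * product qs < b * totient qs → a * suc n < b * (2 * c)
    totient> {a} {b} h = *-cancelʳ-< (product qs) _ _ (begin-strict
      a * suc n * product qs   ≡⟨ move₁ a (suc n) (product qs) ⟩
      suc n * (a * product qs) <⟨ *-monoʳ-< (suc n) h ⟩
      suc n * (b * totient qs) ≡⟨ move₂ b (suc n) (totient qs) ⟩
      b * (suc n * totient qs) ≡⟨ cong (b *_) half-totient ⟨
      b * (2 * c * product qs) ≡⟨ *-assoc b (2 * c) (product qs) ⟨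
      b * (2 * c) * product qs ∎)
      where open ≤-Reasoning

    totient≤ : ∀ {a b} → b * totient qs ≤ a * product qs → b * (2 * c) ≤ a * suc n
    totient≤ {a} {b} h = *-cancelʳ-≤ _ _ (product qs) {{productOfPrimes≢0 primes}} (begin
      b * (2 * c) * product qs ≡⟨ *-assoc b (2 * c) (product qs) ⟩
      b * (2 * c * product qs) ≡⟨ cong (b *_) half-totient ⟩
      b * (suc n * totient qs) ≡⟨ move₂ b (suc n) (totient qs) ⟨
      suc n * (b * totient qs) ≤⟨ *-monoʳ-≤ (suc n) h ⟩
      suc n * (a * product qs) ≡⟨ move₁ a (suc n) (product qs) ⟨
      a * suc n * product qs   ∎)
      where open ≤-Reasoning

    -- The class of 2 holds M - c friends and c enemies of N, so its defeat is a comparison of M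
    -- with 2c + `size q`.
    wins-even : M < 2 * c + size q → Wins 2
    wins-even h = +-cancelʳ-< c _ _ (begin-strict
      friendCount 2 + c         ≡⟨ friends+c≡M ⟩
      M                         <⟨ h ⟩
      2 * c + size q            ≡⟨ eq c (size q) ⟩
      c + size q + c            ≡⟨ cong (λ e → e + size q + c) enemyCount≡ ⟨
      enemyCount 2 + size q + c ∎)
      where
      open ≤-Reasoning
      eq : ∀ c s → 2 * c + s ≡ c + s + c
      eq = solve-∀

    module _ (q≡3 : q ≡ 3) where
      2M≡ : 2 * M ≡ 3 * y + 2
      2M≡ = suc-injective (trans (cong suc (sym n≡2M)) (trans N≡ (trans (cong (suc y *_) q≡3) (eq y))))
        where
        eq : ∀ y → suc y * 3 ≡ suc (3 * y + 2)
        eq = solve-∀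

      wins-2-3 : 1 * product qs < 3 * totient qs → Wins 2
      -- Writing 6M as 2 · 2M + 2M and using 2M = n once and 2M = 3y + 2 once separates two
      -- comparisons: N / 3 with 2c = φ(N), and y / 2 with the class of 3.
      wins-2-3 h = wins-even (*-cancelˡ-< 6 M (2 * c + size q) (begin-strict
        6 * M                                ≡⟨ eq₁ M ⟩
        2 * (2 * M) + 2 * M                  ≡⟨ cong₂ _+_ (cong (2 *_) (sym n≡2M)) 2M≡ ⟩
        2 * n + (3 * y + 2)                  ≡⟨ eq₂ n y ⟩
        2 * (1 * suc n) + 3 * y              <⟨ +-mono-<-≤ (*-monoʳ-< 2 (totient> {1} {3} h)) (*-monoʳ-≤ 3 y≤) ⟩
        2 * (3 * (2 * c)) + 3 * (2 * size q) ≡⟨ eq₃ c (size q) ⟩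
        6 * (2 * c + size q)                 ∎))
        where
        open ≤-Reasoning
        y≤ : y ≤ 2 * size q
        y≤ = begin
          y                               ≡⟨ *-identityˡ y ⟨
          1 * y                           ≤⟨ Density.lower density₂ y ⟩
          2 * Density.A density₂ y + 0    ≡⟨ +-identityʳ _ ⟩
          2 * Density.A density₂ y        ≤⟨ *-monoʳ-≤ 2 (A≤rough {3} (m≤m+n 3 5) y) ⟩
          2 * count (3 rough?_) y         ≡⟨ cong (λ q → 2 * count (q rough?_) y) q≡3 ⟨
          2 * size q                      ∎
        eq₁ : ∀ M → 6 * M ≡ 2 * (2 * M) + 2 * M
        eq₁ = solve-∀
        eq₂ : ∀ n y → 2 * n + (3 * y + 2) ≡ 2 * (1 * suc n) + 3 * y
        eq₂ = solve-∀
        eq₃ : ∀ c s → 2 * (3 * (2 * c)) + 3 * (2 * s) ≡ 6 * (2 * c + s)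
        eq₃ = solve-∀

      loses-2-3 : 3 * totient qs ≤ 1 * product qs → enemyCount 2 + size q ≤ friendCount 2
      loses-2-3 h = +-cancelʳ-≤ c _ _ (begin
        enemyCount 2 + size q + c ≡⟨ cong (λ e → e + size q + c) enemyCount≡ ⟩
        c + size q + c            ≡⟨ eq c (size q) ⟩
        2 * c + size q            ≤⟨ ≤-pred (*-cancelˡ-< 6 (2 * c + size q) (suc M) bound) ⟩
        M                         ≡⟨ friends+c≡M ⟨
        friendCount 2 + c         ∎)
        where
        open ≤-Reasoning
        eq : ∀ c s → c + s + c ≡ 2 * c + s
        eq = solve-∀
        ≤y+1 : 2 * size q ≤ y + 1
        ≤y+1 = begin
          2 * size q               ≡⟨ cong (λ q → 2 * count (q rough?_) y) q≡3 ⟩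
          2 * count (3 rough?_) y  ≤⟨ *-monoʳ-≤ 2 (rough≤A 3 y) ⟩
          2 * Density.A density₂ y ≤⟨ Density.upper density₂ y ⟩
          1 * y + 1                ≡⟨ cong (_+ 1) (*-identityˡ y) ⟩
          y + 1                    ∎
        -- The rounding in the size of the class of 3 costs only 3 out of 6, so by integrality
        -- `2 * c + size q` still does not exceed `M`.
        bound : 6 * (2 * c + size q) < 6 * suc M
        bound = begin-strict
          6 * (2 * c + size q)                 ≡⟨ eq₁ c (size q) ⟩
          2 * (3 * (2 * c)) + 3 * (2 * size q) ≤⟨ +-mono-≤ (*-monoʳ-≤ 2 (totient≤ {1} {3} h)) (*-monoʳ-≤ 3 ≤y+1) ⟩
          2 * (1 * suc n) + 3 * (y + 1)        ≡⟨ eq₂ n y ⟩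
          2 * n + (3 * y + 2) + 3              <⟨ +-monoʳ-< _ (m≤m+n 4 2) ⟩
          2 * n + (3 * y + 2) + 6              ≡⟨ cong₂ (λ a b → 2 * a + b + 6) n≡2M (sym 2M≡) ⟩
          2 * (2 * M) + 2 * M + 6              ≡⟨ eq₃ M ⟩
          6 * suc M                            ∎
          where
          eq₁ : ∀ c s → 6 * (2 * c + s) ≡ 2 * (3 * (2 * c)) + 3 * (2 * s)
          eq₁ = solve-∀
          eq₂ : ∀ n y → 2 * (1 * suc n) + 3 * (y + 1) ≡ 2 * n + (3 * y + 2) + 3
          eq₂ = solve-∀
          eq₃ : ∀ M → 2 * (2 * M) + 2 * M + 6 ≡ 6 * suc M
          eq₃ = solve-∀

    module _ (q≡5 : q ≡ 5) where
      wins-2-5 : 11 * product qs < 25 * totient qs → Wins 2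
      -- Asymptotically φ(N) / N > 1/2 - 1/15 = 13/30 is needed. The slightly larger 11/25 gains
      -- `5 * y`, which pays for the rounding loss of 20 because y ≥ 4.
      wins-2-5 h = wins-even (*-cancelˡ-< 150 M (2 * c + size q) (+-cancelʳ-< 50 _ _ (begin-strict
        150 * M + 50                   ≡⟨ eq₁ M ⟩
        75 * (2 * M) + 50              ≡⟨ cong (λ n → 75 * n + 50) (trans (sym n≡2M) (n≡ q≡5)) ⟩
        75 * (5 * y + 4) + 50          ≡⟨ eq₂ y ⟩
        375 * y + 330 + 5 * 4          ≤⟨ +-monoʳ-≤ (375 * y + 330) (*-monoʳ-≤ 5 (4≤y q≡5)) ⟩
        375 * y + 330 + 5 * y          ≡⟨ eq₄ y ⟩
        6 * (11 * suc (5 * y + 4)) + 50 * y ≡⟨ cong (λ n → 6 * (11 * suc n) + 50 * y) (n≡ q≡5) ⟨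
        6 * (11 * suc n) + 50 * y      <⟨ +-mono-<-≤ (*-monoʳ-< 6 (totient> {11} {25} h)) (*-monoʳ-≤ 50 (y≤₅ q≡5)) ⟩
        6 * (25 * (2 * c)) + 50 * (3 * size q + 1) ≡⟨ eq₃ c (size q) ⟩
        150 * (2 * c + size q) + 50    ∎)))
        where
        open ≤-Reasoning
        eq₁ : ∀ M → 150 * M + 50 ≡ 75 * (2 * M) + 50
        eq₁ = solve-∀
        eq₂ : ∀ y → 75 * (5 * y + 4) + 50 ≡ 375 * y + 330 + 5 * 4
        eq₂ = solve-∀
        eq₄ : ∀ y → 375 * y + 330 + 5 * y ≡ 6 * (11 * suc (5 * y + 4)) + 50 * y
        eq₄ = solve-∀
        eq₃ : ∀ c s → 6 * (25 * (2 * c)) + 50 * (3 * s + 1) ≡ 150 * (2 * c + s) + 50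
        eq₃ = solve-∀

  -- All classes of smaller primes lose below n₀

  module _ (N<n₀ : suc n < n₀) where

    -- The product of the distinct prime factors is at most N and hence below `n₀`, so a successful
    -- scan covers a list that bounds these factors from below termwise.
    dominated : ∀ {t} c → c < q → T (scan t n₀ 1 (primesAbove c)) →
                ∃ λ rs → Pointwise _≤_ rs qs × T (t rs)
    dominated c c<q ok = scan-sound 1 ok
      (primesAbove-≼ c sorted primes (All.map (<-≤-trans c<q) q≤qs)) 1≤qs
      (≤-<-trans (≤-reflexive (*-identityˡ (product qs))) (≤-<-trans product≤ N<n₀))

    wins-3-5 : ∀ K → 1 ≤ K → (∃ λ rs → Pointwise _≤_ rs qs × T (ThreeFive.test₃₅ K rs)) → q ≡ 5 → Wins 3
    wins-3-5 K 1≤K (rs , rs≤qs , ok) q≡5 =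
      wins 3 (ThreeFive.test₃₅-sound K {rs} {qs} {x} {y} {friendCount 3} {size 3} {size q} 1≤K ok
        -- From y ≥ 4 follows n = 5y + 4 ≥ 24, hence the constant 8 in `threshold₃₅`.
        (⊔-lub (≤-÷ (s≤s z≤n) (≤-trans (+-monoˡ-≤ 4 (*-monoʳ-≤ 5 (4≤y q≡5))) (≤-reflexive (sym (n≡ q≡5)))))
               (÷-monoˡ 3 (pred-mono-≤ (≤-trans (pointwise-product rs≤qs) product≤))))
        rs≤qs 1≤qs
        (count-anyDivides x (3 rough?_) (avoids? (2 ∷ [])) qs 1≤qs λ r rl-rough →
           rough⇒avoids (sieve-bounds 3) (rough∧∣⇒rough rl-rough (n∣m*n r)))
        x≤ (y≤₅ q≡5) (≤-trans (÷-*-≤ n 3) (≤-reflexive (n≡ q≡5))))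
      where
      open ≤-Reasoning
      x = n ÷ 3
      x≤ : x ≤ 2 * size 3
      x≤ = begin
        x                            ≡⟨ *-identityˡ x ⟨
        1 * x                        ≤⟨ Density.lower density₂ x ⟩
        2 * Density.A density₂ x + 0 ≡⟨ +-identityʳ _ ⟩
        2 * Density.A density₂ x     ≤⟨ *-monoʳ-≤ 2 (A≤rough {3} (m≤m+n 3 5) x) ⟩
        2 * size 3                   ∎

    wins-large : ∀ {P} → Prime P → P < q → 5 < q → P * P * P ≤ n → Wins P
    wins-large {P} P-prime P<q 5<q P³≤n =
      [ (λ P∈ → [ (λ n₀≤P³ → contradiction (≤ᵇ⇒≤ n₀ _ n₀≤P³) (<⇒≱ P³<n₀)) , checked ]′
                  (∨-T {n₀ ≤ᵇ P * P * P} (All.lookup sieveChecked P∈)))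
      , (λ 541<P → contradiction P≤541 (<⇒≱ 541<P)) ]′ (prime⇒∈primesTo541 P-prime)
      where
      P³<n₀ : P * P * P < n₀
      P³<n₀ = ≤-<-trans P³≤n (<-trans (n<1+n n) N<n₀)
      P≤541 : P ≤ 541
      P≤541 = ≮⇒≥ λ 541<P → let 541≤P = <⇒≤ 541<P in
        <⇒≱ P³<n₀ (≤-trans (≤ᵇ⇒≤ n₀ (541 * 541 * 541) tt) (*-mono-≤ (*-mono-≤ 541≤P 541≤P) 541≤P))
      checked : T (scan (SieveTest.sieveTest 1000000 P) n₀ 1 (primesAbove (5 ⊔ P))) → Wins P
      checked ok = let (rs , rs≤qs , ok′) = dominated (5 ⊔ P) (⊔-lub 5<q P<q) ok in
        wins P (≤-<-trans
          (SieveTest.sieveTest-sound 1000000 P (s≤s z≤n) P-prime P≤541 rs≤qs 1≤qs ok′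
            (⊔-lub (≤-÷ (prime⇒1≤ P-prime) P³≤n)
                   (÷-monoˡ P (pred-mono-≤ (≤-trans (pointwise-product rs≤qs) product≤)))))
          (m<m+n _ 1≤size))

    wins-even-3 : (∃ λ rs → Pointwise _≤_ rs qs × T (test₃ rs)) → q ≡ 3 → Wins 2
    wins-even-3 (rs , rs≤qs , ok) q≡3 = wins-2-3 (subst (2 <_) (sym q≡3) ≤-refl) q≡3
      (totient-bound {rs} {qs} {1} {3} rs≤qs 1≤qs (<ᵇ⇒< (1 * product rs) (3 * totient rs) ok))

    wins-even-5 : (∃ λ rs → Pointwise _≤_ rs qs × T (test₅ rs)) → q ≡ 5 → Wins 2
    wins-even-5 (rs , rs≤qs , ok) q≡5 = wins-2-5 (subst (2 <_) (sym q≡5) (m≤m+n 3 2)) q≡5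
      (totient-bound {rs} {qs} {11} {25} rs≤qs 1≤qs (<ᵇ⇒< (11 * product rs) (25 * totient rs) ok))

    wins-all : ∀ {P} → Prime P → P < q → Wins P
    wins-all {P} P-prime P<q with 5 <? q
    ... | yes 5<q with P * P * P ≤? n
    ...   | yes P³≤n = wins-large P-prime P<q 5<q P³≤n
    ...   | no  P³≰n = wins-small P-prime P<q (≤∧≢⇒< (≰⇒> P³≰n) λ N≡P³ →
              P∤N P-prime P<q (divides (P * P) N≡P³))
    wins-all {P} P-prime P<q | no 5≮q = small P q P-prime q-prime P<q (≮⇒≥ 5≮q) refl
      where
      small : ∀ P q′ → Prime P → Prime q′ → P < q′ → q′ ≤ 5 → q ≡ q′ → Wins P
      small 0 _ P-prime _ _ _ _ = contradiction P-prime ¬prime[0]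
      small 1 _ P-prime _ _ _ _ = contradiction P-prime ¬prime[1]
      small 2 3 _ _ _ _ q≡3 = wins-even-3 (dominated {test₃} 2 (subst (2 <_) (sym q≡3) ≤-refl) checked₃) q≡3
      small 2 5 _ _ _ _ q≡5 = wins-even-5 (dominated {test₅} 4 (subst (4 <_) (sym q≡5) ≤-refl) checked₅) q≡5
      small 3 5 _ _ _ _ q≡5 = wins-3-5 1000000 (s≤s z≤n)
        (dominated {ThreeFive.test₃₅ 1000000} 4 (subst (4 <_) (sym q≡5) ≤-refl) checked₃₅) q≡5
      small _ 4 _ 4-prime _ _ _ = contradiction 4-prime (composite⇒¬prime composite[4])
      small 4 _ 4-prime _ _ _ _ = contradiction 4-prime (composite⇒¬prime composite[4])
      small (suc (suc P)) (suc (suc (suc (suc (suc (suc _)))))) _ _ _ (s≤s (s≤s (s≤s (s≤s (s≤s ()))))) _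
      small _ 0 _ _ () _ _
      small (suc _) 1 _ _ (s≤s ()) _ _
      small (suc (suc _)) 2 _ _ (s≤s (s≤s ())) _ _
      small (suc (suc (suc _))) 3 _ _ (s≤s (s≤s (s≤s ()))) _ _
      small (suc (suc (suc (suc (suc _))))) 5 _ _ (s≤s (s≤s (s≤s (s≤s (s≤s ()))))) _ _

-- The greedy step

p-prime : ∀ i → Prime (p (suc i))
p-prime i = proj₁ (proj₂ (proj₂ (nextPrime (p i))))

p-step : ∀ i → p i < p (suc i)
p-step i = proj₁ (proj₂ (nextPrime (p i)))

p-least : ∀ i → p i < r → Prime r → p (suc i) ≤ r
p-least i = proj₂ (proj₂ (proj₂ (nextPrime (p i))))

p-mono-< : ∀ {i j} → i < j → p i < p j
p-mono-< {i} i<j = go (≤⇒≤′ i<j)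
  where
  go : ∀ {j} → suc i ≤′ j → p i < p j
  go ≤′-refl       = p-step i
  go {suc j} (≤′-step i<j) = <-trans (go i<j) (p-step j)

p-mono-≤ : ∀ {i j} → i ≤ j → p i ≤ p j
p-mono-≤ i≤j with m≤n⇒m<n∨m≡n i≤j
... | inj₁ i<j  = <⇒≤ (p-mono-< i<j)
... | inj₂ refl = ≤-refl

p-cancel-< : ∀ {i j} → p i < p j → i < j
p-cancel-< pi<pj = ≰⇒> λ j≤i → <⇒≱ pi<pj (p-mono-≤ j≤i)

n≤p : ∀ i → i ≤ p i
n≤p zero    = z≤n
n≤p (suc i) = ≤-<-trans (n≤p i) (p-step i)

-- Walking through the primes, either `r` has been met or `p k` is still below `r`; the latter fails
-- at `k` equal to `r` because `r ≤ p r`.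
p-surjective : Prime r → ∃ λ i → p (suc i) ≡ r
p-surjective {r} r-prime = [ id , (λ pr<r → contradiction (n≤p r) (<⇒≱ pr<r)) ]′ (go r)
  where
  go : ∀ k → (∃ λ i → p (suc i) ≡ r) ⊎ p k < r
  go zero    = inj₂ (prime⇒1≤ r-prime)
  go (suc k) with go k
  ... | inj₁ found = inj₁ found
  ... | inj₂ pk<r with m≤n⇒m<n∨m≡n (p-least k pk<r r-prime)
  ...   | inj₁ p<r = inj₂ p<r
  ...   | inj₂ p≡r = inj₁ (k , p≡r)

-- The sets S as rough multiples of a prime

Class : ℕ → Pred ℕ 0ℓ
Class P a = P ∣ a × P Rough a

class? : ∀ P → Decidable (Class P)
class? P = (P ∣?_) ∩? (P rough?_)

S⇒Class : ∀ {i a} → S (suc i) n a → Class (p (suc i)) a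
S⇒Class {i = i} {a} (_ , _ , p∣a , p∤a) = p∣a , ∤⇒rough λ {r} r-prime r<p r∣a →
  let (j , p≡r) = p-surjective r-prime in
  p∤a (suc j) (s≤s z≤n) (p-cancel-< (subst (_< p (suc i)) (sym p≡r) r<p)) (subst (_∣ a) (sym p≡r) r∣a)

Class⇒S : ∀ {i a} → 1 ≤ a → a ≤ n → Class (p (suc i)) a → S (suc i) n a
Class⇒S 1≤a a≤n (p∣a , a-rough) =
  1≤a , a≤n , p∣a , λ { (suc j) _ j<i → rough⇒∤ a-rough (p-prime j) (p-mono-< j<i) }

S-mono : ∀ {i a} → m ≤ n → S i m a → S i n a
S-mono m≤n (1≤a , a≤m , rest) = 1≤a , ≤-trans a≤m m≤n , rest

S-pred : ∀ {i a} → a ≢ suc n → S i (suc n) a → S i n a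
S-pred a≢ (1≤a , a≤1+n , rest) = 1≤a , ≤-pred (≤∧≢⇒< a≤1+n a≢) , rest

S⇒p≤ : ∀ {i a} → S i n a → p i ≤ a
S⇒p≤ (1≤a , _ , p∣a , _) = ∣⇒≤ {{>-nonZero 1≤a}} p∣a

p∈S : ∀ {i} → p (suc i) ≤ n → S (suc i) n (p (suc i))
p∈S {i = i} p≤n = Class⇒S (prime⇒1≤ (p-prime i)) p≤n (∣-refl , prime⇒rough (p-prime i))

-- The classes of a partition, numbered from j, are X j, X (1 + j), ….
data Represents (X : ℕ → Pred ℕ 0ℓ) (j : ℕ) : Partition → Set where
  []  : Represents X j []
  _∷_ : ∀ {C Ps} → (_∈ C) ≐ X j → Represents X (suc j) Ps → Represents X j (C ∷ Ps)

≐-trans : {U V W : Pred ℕ 0ℓ} → U ≐ V → V ≐ W → U ≐ W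
≐-trans (f , g) (f′ , g′) = f′ ∘ f , g ∘ g′

reindex : (X : ℕ → Pred ℕ 0ℓ) {U : Pred ℕ 0ℓ} → m ≡ n → U ≐ X m → U ≐ X n
reindex X refl U≐ = U≐

module _ {X X′ : ℕ → Pred ℕ 0ℓ} where

  represents-cong : ∀ {j Ps} → (∀ {k} → j ≤ k → k < j + length Ps → X k ≐ X′ k) →
                    Represents X j Ps → Represents X′ j Ps
  represents-cong X≐X′ [] = []
  represents-cong {j} {C ∷ Ps} X≐X′ (C≐ ∷ rep) =
    ≐-trans C≐ (X≐X′ ≤-refl (m<m+n j (s≤s z≤n))) ∷
    represents-cong (λ {k} j<k k< → X≐X′ (<⇒≤ j<k) (subst (k <_) (sym (+-suc j (length Ps))) k<)) rep

  represents-∷ʳ : ∀ {j Ps C} → (∀ {k} → j ≤ k → k < j + length Ps → X k ≐ X′ k) →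
                  Represents X j Ps → (_∈ C) ≐ X′ (j + length Ps) → Represents X′ j (Ps ∷ʳ C)
  represents-∷ʳ {j} {[]} X≐X′ [] C≐ = reindex X′ (+-identityʳ j) C≐ ∷ []
  represents-∷ʳ {j} {D ∷ Ps} X≐X′ (D≐ ∷ rep) C≐ =
    ≐-trans D≐ (X≐X′ ≤-refl (m<m+n j (s≤s z≤n))) ∷
    represents-∷ʳ (λ {k} j<k k< → X≐X′ (<⇒≤ j<k) (subst (k <_) (sym (+-suc j (length Ps))) k<)) rep
      (reindex X′ (+-suc j (length Ps)) C≐)

  represents-%= : ∀ {j Ps N} (t : Fin (length Ps)) → (∀ {k} → j ≤ k → k ≢ j + toℕ t → X k ≐ X′ k) →
                  (∀ {C} → (_∈ C) ≐ X (j + toℕ t) → (_∈ C ∷ʳ N) ≐ X′ (j + toℕ t)) →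
                  Represents X j Ps → Represents X′ j (Ps [ t ]%= (_∷ʳ N))
  represents-%= {j} zero X≐X′ ext (C≐ ∷ rep) =
    reindex X′ (+-identityʳ j) (ext (reindex X (sym (+-identityʳ j)) C≐)) ∷
    represents-cong (λ j<k _ → X≐X′ (<⇒≤ j<k) λ k≡j → <⇒≢ j<k (sym (trans k≡j (+-identityʳ j)))) rep
  represents-%= {j} (suc t) X≐X′ ext (C≐ ∷ rep) =
    ≐-trans C≐ (X≐X′ ≤-refl (<⇒≢ (m<m+n j (s≤s z≤n)))) ∷
    represents-%= t (λ j<k k≢ → X≐X′ (<⇒≤ j<k) (k≢ ∘ λ k≡ → trans k≡ (+-suc j (toℕ t))))
      (λ {C} C≐ → reindex X′ (+-suc j (toℕ t)) (ext (reindex X (sym (+-suc j (toℕ t))) C≐))) rep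

module _ {X : ℕ → Pred ℕ 0ℓ} where

  represents-lookup : ∀ {j Ps} → Represents X j Ps → (t : Fin (length Ps)) → (_∈ lookup Ps t) ≐ X (j + toℕ t)
  represents-lookup {j} (C≐ ∷ rep) zero    = reindex X (sym (+-identityʳ j)) C≐
  represents-lookup {j} (C≐ ∷ rep) (suc t) = reindex X (sym (+-suc j (toℕ t))) (represents-lookup rep t)

  represents-∈ : ∀ {j Ps C} → Represents X j Ps → C ∈ Ps → ∃ λ k → j ≤ k × k < j + length Ps × (_∈ C) ≐ X k
  represents-∈ {j} (C≐ ∷ rep) (here refl) = j , ≤-refl , m<m+n j (s≤s z≤n) , C≐
  represents-∈ {j} {D ∷ Ps} (_ ∷ rep) (there C∈) with represents-∈ rep C∈
  ... | k , j<k , k< , C≐ = k , <⇒≤ j<k , subst (k <_) (sym (+-suc j (length Ps))) k< , C≐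

  represents-∋ : ∀ {j Ps k} → Represents X j Ps → j ≤ k → k < j + length Ps → ∃ λ C → C ∈ Ps × (_∈ C) ≐ X k
  represents-∋ {j} {k = k} [] j≤k k<j = contradiction (subst (k <_) (+-identityʳ j) k<j) (≤⇒≯ j≤k)
  represents-∋ {j} {C ∷ Ps} {k} (C≐ ∷ rep) j≤k k< with m≤n⇒m<n∨m≡n j≤k
  ... | inj₂ refl = C , here refl , C≐
  ... | inj₁ j<k with represents-∋ rep j<k (subst (k <_) (+-suc j (length Ps)) k<)
  ...   | D , D∈ , D≐ = D , there D∈ , D≐

-- The minimising option and the number of conflicts

argmin-unique : ∀ {k} (f : Fin (suc k) → ℕ) i → (∀ j → j Fin.< i → f i < f j) →
                (∀ j → i Fin.< j → f i ≤ f j) → argmin f ≡ i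
argmin-unique {zero}  f zero    _      _     = refl
argmin-unique {suc k} f zero    before after =
  cong (λ b → if b then zero else suc (argmin (f ∘ suc))) (dec-true (f zero ≤? _) (after (suc _) (s≤s z≤n)))
argmin-unique {suc k} f (suc i) before after = begin
  argmin f                                                        ≡⟨⟩
  (if does (f zero ≤? f (suc j)) then zero else suc j)
    ≡⟨ cong (λ j → if does (f zero ≤? f (suc j)) then zero else suc j) j≡i ⟩
  (if does (f zero ≤? f (suc i)) then zero else suc i)
    ≡⟨ cong (λ b → if b then zero else suc i) (dec-false (f zero ≤? f (suc i)) (<⇒≱ (before zero (s≤s z≤n)))) ⟩
  suc i                                                           ∎
  where
  open ≡-Reasoning
  j = argmin (f ∘ suc)
  j≡i : j ≡ i
  j≡i = argmin-unique (f ∘ suc) i (λ j j<i → before (suc j) (s≤s j<i)) (λ j i<j → after (suc j) (s≤s i<j))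

length-filter : (Q? : Decidable Q) → ∀ m → length (filter Q? (applyUpTo suc m)) ≡ count Q? m
length-filter Q? zero    = refl
length-filter Q? (suc m) = begin
  length (filter Q? (applyUpTo suc (suc m)))                    ≡⟨ cong (length ∘ filter Q?) (applyUpTo-∷ʳ suc m) ⟨
  length (filter Q? (applyUpTo suc m ++ [ suc m ]))             ≡⟨ cong length (filter-++ Q? (applyUpTo suc m) [ suc m ]) ⟩
  length (filter Q? (applyUpTo suc m) ++ filter Q? [ suc m ])   ≡⟨ length-++ (filter Q? (applyUpTo suc m)) ⟩
  length (filter Q? (applyUpTo suc m)) + length (filter Q? [ suc m ]) ≡⟨ cong₂ _+_ (length-filter Q? m) single ⟩
  count Q? m + ⟦ Q? (suc m) ⟧                                   ≡⟨ +-comm (count Q? m) _ ⟩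
  ⟦ Q? (suc m) ⟧ + count Q? m                                   ∎
  where
  open ≡-Reasoning
  single : length (filter Q? [ suc m ]) ≡ ⟦ Q? (suc m) ⟧
  single with does (Q? (suc m))
  ... | true  = refl
  ... | false = refl

-- `conflicts` ranges over 2, ..., n but `count` over 1, ..., n, so the value 1 has to be ruled out
-- as a conflict.
conflicts≡count : ∀ Ps → ¬ Conflict Ps 1 (suc n) → 1 ≤ n → conflicts Ps (suc n) ≡ count (λ a → conflict? Ps a (suc n)) n
conflicts≡count {suc n} Ps ¬conflict _ = trans
  (cong length (sym (filter-reject (λ a → conflict? Ps a (suc (suc n))) {x = 1} {xs = applyUpTo (2 +_) n} ¬conflict)))
  (length-filter (λ a → conflict? Ps a (suc (suc n))) (suc n))

module _ {N : ℕ} where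

  ¬sameClass-∷ʳ : ∀ {a Ps} → All (N ∉_) Ps → a ≢ N → ¬ SameClass (Ps ∷ʳ [ N ]) a N
  ¬sameClass-∷ʳ {Ps = Ps} N∉ a≢N same with Any.++⁻ Ps same
  ... | inj₁ old with find old
  ...   | C , C∈ , _ , N∈C = All.lookup N∉ C∈ N∈C
  ¬sameClass-∷ʳ N∉ a≢N same | inj₂ (here (here a≡N , _)) = a≢N a≡N

  sameClass-%=⁻ : ∀ {a Ps} (t : Fin (length Ps)) → All (N ∉_) Ps → a ≢ N →
                  SameClass (Ps [ t ]%= (_∷ʳ N)) a N → a ∈ lookup Ps t
  sameClass-%=⁻ {Ps = C ∷ Ps} zero (_ ∷ N∉) a≢N (here (a∈ , _)) with ∈-++⁻ C a∈
  ... | inj₁ a∈C        = a∈C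
  ... | inj₂ (here a≡N) = contradiction a≡N a≢N
  sameClass-%=⁻ {Ps = C ∷ Ps} zero (_ ∷ N∉) a≢N (there same) with find same
  ... | D , D∈ , _ , N∈D = contradiction N∈D (All.lookup N∉ D∈)
  sameClass-%=⁻ {Ps = C ∷ Ps} (suc t) (N∉C ∷ N∉) a≢N (here (_ , N∈C)) = contradiction N∈C N∉C
  sameClass-%=⁻ {Ps = C ∷ Ps} (suc t) (N∉C ∷ N∉) a≢N (there same)     = sameClass-%=⁻ t N∉ a≢N same

  sameClass-%=⁺ : ∀ {a Ps} (t : Fin (length Ps)) → a ∈ lookup Ps t → SameClass (Ps [ t ]%= (_∷ʳ N)) a N
  sameClass-%=⁺ {Ps = C ∷ Ps} zero    a∈C = here (∈-++⁺ˡ a∈C , ∈-++⁺ʳ C (here refl))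
  sameClass-%=⁺ {Ps = C ∷ Ps} (suc t) a∈  = there (sameClass-%=⁺ t a∈)

-- The invariant of the algorithm

≐-sym : {U V : Pred ℕ 0ℓ} → U ≐ V → V ≐ U
≐-sym (f , g) = g , f

-- The fields `below` and `above` say that the number of classes is π(n), so that the represented
-- sets are exactly the nonempty `S j n`.
record State (n : ℕ) (Ps : Partition) : Set where
  field
    represents : Represents (λ j → S j n) 1 Ps
    below      : p (length Ps) ≤ n
    above      : n < p (suc (length Ps))

S⇒index : ∀ {M j a} → n < p (suc M) → S j n a → j < suc M
S⇒index {n} n<p a∈S@(_ , a≤n , _) = p-cancel-< (≤-<-trans (≤-trans (S⇒p≤ a∈S) a≤n) n<p)

S-satisfiable : ∀ {M k} → p M ≤ n → 1 ≤ k → k < suc M → Satisfiable (S k n)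
S-satisfiable {k = suc k} p≤n _ k<1+M = p (suc k) , p∈S (≤-trans (p-mono-≤ (≤-pred k<1+M)) p≤n)

state⇒≋ : ∀ {n Ps} → State n Ps → Ps ≋ (λ X → ∃[ j ] (1 ≤ j × Satisfiable (S j n) × X ≐ S j n))
state⇒≋ state = sound , complete
  where
  open State state
  sound = λ C C∈ → let (k , 1≤k , k<1+M , C≐) = represents-∈ represents C∈ in
    k , 1≤k , S-satisfiable below 1≤k k<1+M , C≐
  complete = λ X (j , 1≤j , (a , a∈S) , X≐) →
    let (C , C∈ , C≐) = represents-∋ represents 1≤j (S⇒index above a∈S) in
    C , C∈ , ≐-trans C≐ (≐-sym X≐)

-- One step: the costs of the options

module Step {n : ℕ} (2≤n : 2 ≤ n) {Ps : Partition} (state : State n Ps) where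
  open State state

  N M : ℕ
  N = suc n
  M = length Ps

  N∉ : All (N ∉_) Ps
  N∉ = All.tabulate λ C∈ N∈C → let (_ , _ , _ , C≐) = represents-∈ represents C∈ in
    <⇒≱ (n<1+n n) (proj₁ (proj₂ (proj₁ C≐ N∈C)))

  friend? : Decidable (λ a → gcd a N > 1)
  friend? a = 1 <? gcd a N

  enemy? : Decidable (λ a → gcd a N ≡ 1)
  enemy? a = gcd a N ≟ 1

  friend⊎enemy : ∀ a → gcd a N > 1 ⊎ gcd a N ≡ 1
  friend⊎enemy a with m≤n⇒m<n∨m≡n (n≢0⇒n>0 λ g≡0 → 1+n≢0 (gcd[m,n]≡0⇒n≡0 a g≡0))
  ... | inj₁ 1<g = inj₁ 1<g
  ... | inj₂ 1≡g = inj₂ (sym 1≡g)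

  ¬friend-1 : ¬ gcd 1 N > 1
  ¬friend-1 g>1 = <⇒≢ g>1 (sym (∣1⇒≡1 (gcd[m,n]∣m 1 N)))

  classPrime : Fin M → ℕ
  classPrime t = p (suc (toℕ t))

  cost : Fin (suc M) → ℕ
  cost o = conflicts (apply Ps N o) N

  ≤n⇒≢N : ∀ {a} → a ≤ n → a ≢ N
  ≤n⇒≢N a≤n a≡N = <⇒≱ (s≤s a≤n) (≤-reflexive (sym a≡N))

  1≤n : 1 ≤ n
  1≤n = <⇒≤ 2≤n

  cost-zero : cost zero ≡ count friend? n
  cost-zero = trans
    (conflicts≡count Ps′ (to ¬friend-1 (≤n⇒≢N 1≤n)) 1≤n)
    (count-cong n (λ a → conflict? Ps′ a N) friend?
      (λ { _ a≤n (inj₁ (_ , same)) → contradiction same (¬sameClass-∷ʳ N∉ (≤n⇒≢N a≤n)) ; _ _ (inj₂ (g>1 , _)) → g>1 })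
      (λ _ a≤n g>1 → inj₂ (g>1 , ¬sameClass-∷ʳ N∉ (≤n⇒≢N a≤n))))
    where
    Ps′ = Ps ∷ʳ [ N ]
    to : ∀ {a} → ¬ gcd a N > 1 → a ≢ N → ¬ Conflict Ps′ a N
    to _    a≢N (inj₁ (_ , same)) = ¬sameClass-∷ʳ N∉ a≢N same
    to ¬g>1 _   (inj₂ (g>1 , _))  = ¬g>1 g>1

  sameClass⇒class : ∀ {a} t → a ≢ N → SameClass (Ps [ t ]%= (_∷ʳ N)) a N → Class (classPrime t) a
  sameClass⇒class t a≢N same = S⇒Class (proj₁ (represents-lookup represents t) (sameClass-%=⁻ t N∉ a≢N same))

  class⇒sameClass : ∀ {a} t → 1 ≤ a → a ≤ n → Class (classPrime t) a → SameClass (Ps [ t ]%= (_∷ʳ N)) a N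
  class⇒sameClass t 1≤a a≤n cls = sameClass-%=⁺ t (proj₂ (represents-lookup represents t) (Class⇒S 1≤a a≤n cls))

  -- Compared with a new class, the friends of N in the joined class stop being in conflict with N
  -- and its enemies there start to be.
  cost-suc : ∀ t → cost (suc t) + count (class? (classPrime t) ∩? friend?) n
                   ≡ count friend? n + count (class? (classPrime t) ∩? enemy?) n
  cost-suc t = trans
    (cong (_+ count (class? Pₜ ∩? friend?) n) (conflicts≡count Ps′ ¬conflict-1 1≤n))
    (count-+ n (λ a → conflict? Ps′ a N) (class? Pₜ ∩? friend?) friend? (class? Pₜ ∩? enemy?) λ {a} 1≤a a≤n →
      indicators (conflict? Ps′ a N) (class? Pₜ a) (friend? a) (enemy? a) (friend⊎enemy a)
        (λ g>1 g≡1 → <⇒≢ g>1 (sym g≡1))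
        (λ { (inj₁ (g≡1 , same))  → inj₁ (g≡1 , sameClass⇒class t (≤n⇒≢N a≤n) same)
           ; (inj₂ (g>1 , ¬same)) → inj₂ (g>1 , ¬same ∘ class⇒sameClass t 1≤a a≤n) })
        (λ { (inj₁ (g≡1 , cls))  → inj₁ (g≡1 , class⇒sameClass t 1≤a a≤n cls)
           ; (inj₂ (g>1 , ¬cls)) → inj₂ (g>1 , ¬cls ∘ sameClass⇒class t (≤n⇒≢N a≤n)) }))
    where
    Pₜ   = classPrime t
    Ps′ = Ps [ t ]%= (_∷ʳ N)
    ¬conflict-1 : ¬ Conflict Ps′ 1 N
    ¬conflict-1 (inj₂ (g>1 , _))  = ¬friend-1 g>1
    ¬conflict-1 (inj₁ (_ , same)) = <⇒≢ (prime⇒2≤ (p-prime (toℕ t)))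
      (sym (∣1⇒≡1 (proj₁ (sameClass⇒class t (≤n⇒≢N 1≤n) same))))
    indicators : ∀ {Cf Cl Fr En : Set} (cf? : Dec Cf) (cl? : Dec Cl) (fr? : Dec Fr) (en? : Dec En) →
      Fr ⊎ En → (Fr → ¬ En) → (Cf → (En × Cl) ⊎ (Fr × ¬ Cl)) → ((En × Cl) ⊎ (Fr × ¬ Cl) → Cf) →
      ⟦ cf? ⟧ + ⟦ cl? ×-dec fr? ⟧ ≡ ⟦ fr? ⟧ + ⟦ cl? ×-dec en? ⟧
    indicators cf? (yes cl) (yes fr) (yes en) _ disj _ _ = contradiction en (disj fr)
    indicators cf? (yes cl) (yes fr) (no ¬en) _ _ to _ =
      cong (_+ 1) (⟦⟧-no cf? λ cf → [ ¬en ∘ proj₁ , (λ (_ , ¬cl) → ¬cl cl) ]′ (to cf))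
    indicators cf? (yes cl) (no ¬fr) (yes en) _ _ _ from = cong (_+ 0) (⟦⟧-yes cf? (from (inj₁ (en , cl))))
    indicators cf? (no ¬cl) (yes fr) en? _ _ _ from = cong (_+ 0) (⟦⟧-yes cf? (from (inj₂ (fr , ¬cl))))
    indicators cf? (no ¬cl) (no ¬fr) en? _ _ to _ =
      cong (_+ 0) (⟦⟧-no cf? λ cf → [ ¬cl ∘ proj₂ , ¬fr ∘ proj₁ ]′ (to cf))
    indicators cf? (yes cl) (no ¬fr) (no ¬en) fr⊎en _ _ _ = contradiction fr⊎en [ ¬fr , ¬en ]′

  -- N enters only the set of its least prime factor: membership in `S k N` would make both `p k`
  -- and `q` the least prime factor of N.
  agree : ∀ {q} → Prime q → q ∣ N → q Rough N → ∀ {k} → 1 ≤ k → p k ≢ q → S k n ≐ S k N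
  agree {q} q-prime q∣N N-rough {suc k} _ p≢q = S-mono {i = suc k} (n≤1+n n) , λ a∈S →
    S-pred {i = suc k} (λ { refl → let (p∣N , N-prough) = S⇒Class {i = k} a∈S in
      p≢q (≤-antisym (rough⇒≥ N-prough 2≤q q∣N) (rough⇒≥ N-rough (prime⇒2≤ (p-prime k)) p∣N)) }) a∈S
    where
    2≤q : 2 ≤ q
    2≤q = prime⇒2≤ q-prime

  -- Prime N

  module _ (N-prime : Prime N) where

    argmin≡zero : argmin cost ≡ zero
    argmin≡zero = argmin-unique cost zero (λ _ ()) λ _ _ → ≤-trans (≤-reflexive cost≡0) z≤n
      where
      cost≡0 : cost zero ≡ 0
      cost≡0 = trans cost-zero (count-none n friend? λ {a} 1≤a a≤n g>1 →
        <⇒≢ g>1 (sym (coprime⇒gcd≡1 (coprime-sym (prime⇒coprime N-prime {{>-nonZero 1≤a}} (s≤s a≤n))))))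

    -- By the invariant the next prime after `p M` is at least N, so a prime N receives exactly the
    -- next index.
    p≡N : p (suc M) ≡ N
    p≡N = ≤-antisym (p-least M (s≤s below) N-prime) above

    stepPrime : State N (greedyStep Ps N)
    stepPrime = subst (λ o → State N (apply Ps N o)) (sym argmin≡zero) record
      { represents = represents-∷ʳ
          (λ {k} 1≤k k<1+M → agree N-prime ∣-refl (prime⇒rough N-prime) 1≤k
             (<⇒≢ (subst (p k <_) p≡N (p-mono-< k<1+M))))
          represents
          ((λ { (here refl) → N∈S }) , λ { {a} a∈S →
             here (≤-antisym (proj₁ (proj₂ a∈S)) (subst (_≤ a) p≡N (S⇒p≤ {i = suc M} a∈S))) })
      ; below = ≤-reflexive (trans (cong p len) p≡N)
      ; above = subst (λ m → N < p (suc m)) (sym len) (subst (_< p (suc (suc M))) p≡N (p-step (suc M)))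
      }
      where
      len : length (Ps ∷ʳ [ N ]) ≡ suc M
      len = trans (length-++ Ps) (+-comm M 1)
      N∈S : S (suc M) N N
      N∈S = Class⇒S (s≤s z≤n) ≤-refl (subst (λ P → Class P N) (sym p≡N) (∣-refl , prime⇒rough N-prime))

  -- Composite N

  module Composite {q : ℕ} (q-prime : Prime q) (q∣N : q ∣ N) (N-rough : q Rough N) (N≢q : N ≢ q)
                   {qs : List ℕ} (supp : Support N qs) where
    open Support supp
    open Tally n supp q-prime q∣N N-rough N≢q using (friendCount; enemyCount; size; size≡; 1≤size; Wins)

    class-size : ∀ {P} → Prime P → count (class? P) n ≡ size P
    class-size {P} P-prime = trans (count-multiples n (P rough?_) (prime⇒1≤ P-prime))
      (count-cong (n ÷ P) (λ l → P rough? (P * l)) (P rough?_)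
         (λ {l} _ _ r → rough∧∣⇒rough r (n∣m*n P)) (λ _ _ → rough-* P-prime ≤-refl))

    module _ {P : ℕ} (P-prime : Prime P) (P<q : P < q) where

      -- `P` is not a prime factor of N, so a prime factor of N dividing `P * l` divides the
      -- cofactor. Friends in the class of `P` can therefore be counted by cofactors.
      strip : ∀ {l} → AnyDivides qs (P * l) → AnyDivides qs l
      strip = anyDivides-*⁻ P-prime primes (All.zipWith (λ (r-prime , r∣N) r∣P →
        rough⇒∤ N-rough P-prime P<q (subst (_∣ N) (prime-∣-prime r-prime P-prime r∣P) r∣N)) (primes , divide))

      class-count : ∀ {Q R : Pred ℕ 0ℓ} (Q? : Decidable Q) (R? : Decidable R) →
                    (∀ {l} → Q (P * l) → R l) → (∀ {l} → R l → Q (P * l)) →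
                    count (class? P ∩? Q?) n ≡ count ((P rough?_) ∩? R?) (n ÷ P)
      class-count Q? R? to from = trans
        (count-cong n (class? P ∩? Q?) ((P ∣?_) ∩? (P rough?_) ∩? Q?)
           (λ _ _ ((d , r) , x) → d , r , x) (λ _ _ (d , r , x) → (d , r) , x))
        (trans (count-multiples n ((P rough?_) ∩? Q?) (prime⇒1≤ P-prime))
          (count-cong (n ÷ P) (λ l → ((P rough?_) ∩? Q?) (P * l)) ((P rough?_) ∩? R?)
             (λ _ _ (r , x) → rough∧∣⇒rough r (n∣m*n P) , to x)
             (λ _ _ (r , x) → rough-* P-prime ≤-refl r , from x)))

      friends≡ : count (class? P ∩? friend?) n ≡ friendCount P
      friends≡ = class-count friend? (anyDivides? qs)
        (λ g>1 → strip (friends⇒anyDivides supp (s≤s z≤n) g>1))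
        (λ any → anyDivides⇒friends supp (s≤s z≤n) (anyDivides-*⁺ P any))

      enemies≡ : count (class? P ∩? enemy?) n ≡ enemyCount P
      enemies≡ = class-count enemy? (avoids? qs)
        (λ g≡1 any → <⇒≢ (anyDivides⇒friends supp (s≤s z≤n) (anyDivides-*⁺ P any)) (sym g≡1))
        (λ {l} ¬any → [ (λ g>1 → contradiction (strip (friends⇒anyDivides supp (s≤s z≤n) g>1)) ¬any) , id ]′
                        (friend⊎enemy (P * l)))

    own-friends : count (class? q ∩? friend?) n ≡ size q
    own-friends = trans
      (count-cong n (class? q ∩? friend?) (class? q) (λ _ _ → proj₁)
        (λ {a} 1≤a _ cls → cls , <-≤-trans (prime⇒2≤ q-prime)
          (∣⇒≤ {{≢-nonZero λ g≡0 → 1+n≢0 (gcd[m,n]≡0⇒n≡0 a g≡0)}} (gcd-greatest (proj₁ cls) q∣N))))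
      (class-size q-prime)

    own-enemies : count (class? q ∩? enemy?) n ≡ 0
    own-enemies = count-none n (class? q ∩? enemy?) λ {a} _ _ ((q∣a , _) , g≡1) →
      <⇒≢ (prime⇒2≤ q-prime) (sym (∣1⇒≡1 (subst (q ∣_) g≡1 (gcd-greatest q∣a q∣N))))

    size-antitone : ∀ P → q ≤ P → size P ≤ size q
    size-antitone P q≤P = ≤-trans
      (count-mono (n ÷ P) (P rough?_) (q rough?_) λ _ _ P-rough → P-rough ∘ λ (hasNonTrivialDivisor d<q d∣k) →
         hasNonTrivialDivisor (<-≤-trans d<q q≤P) d∣k)
      (count-monoʳ (q rough?_) (≤-÷ {n ÷ P} (prime⇒1≤ q-prime) (≤-trans (*-monoʳ-≤ (n ÷ P) q≤P) (÷-*-≤ n P))))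

    module Own (t₀ : Fin M) (p≡q : classPrime t₀ ≡ q) where

      own-cost : cost (suc t₀) + size q ≡ cost zero
      own-cost = begin
        cost (suc t₀) + size q                              ≡⟨ cong (cost (suc t₀) +_) own-friends ⟨
        cost (suc t₀) + count (class? q ∩? friend?) n       ≡⟨ cong (λ P → cost (suc t₀) + count (class? P ∩? friend?) n) p≡q ⟨
        cost (suc t₀) + count (class? (classPrime t₀) ∩? friend?) n ≡⟨ cost-suc t₀ ⟩
        count friend? n + count (class? (classPrime t₀) ∩? enemy?) n
          ≡⟨ cong₂ _+_ (sym cost-zero) (trans (cong (λ P → count (class? P ∩? enemy?) n) p≡q) own-enemies) ⟩
        cost zero + 0                                       ≡⟨ +-identityʳ (cost zero) ⟩
        cost zero                                           ∎
        where open ≡-Reasoning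

      own<zero : cost (suc t₀) < cost zero
      own<zero = <-≤-trans (m<m+n _ 1≤size) (≤-reflexive own-cost)

      -- Even if all members of a later class were friends of N, they would number at most `size q`.
      -- A tie is harmless, as it goes to the smaller index.
      later : ∀ t → toℕ t₀ ≤ toℕ t → cost (suc t₀) ≤ cost (suc t)
      later t t₀≤t = +-cancelʳ-≤ (size q) _ _ (begin
        cost (suc t₀) + size q                 ≡⟨ own-cost ⟩
        cost zero                              ≡⟨ cost-zero ⟩
        count friend? n                        ≤⟨ m≤m+n _ _ ⟩
        count friend? n + count (class? Pₜ ∩? enemy?) n ≡⟨ cost-suc t ⟨
        cost (suc t) + count (class? Pₜ ∩? friend?) n
          ≤⟨ +-monoʳ-≤ (cost (suc t)) (≤-trans (count-mono n (class? Pₜ ∩? friend?) (class? Pₜ) λ _ _ → proj₁)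
                                               (≤-reflexive (class-size Pₜ-prime))) ⟩
        cost (suc t) + size Pₜ                  ≤⟨ +-monoʳ-≤ (cost (suc t)) (size-antitone Pₜ q≤Pₜₜ) ⟩
        cost (suc t) + size q                  ∎)
        where
        open ≤-Reasoning
        Pₜ = classPrime t
        Pₜ-prime = p-prime (toℕ t)
        q≤Pₜₜ : q ≤ Pₜ
        q≤Pₜₜ = subst (_≤ Pₜ) p≡q (p-mono-≤ (s≤s t₀≤t))

      module _ (t : Fin M) (t<t₀ : toℕ t < toℕ t₀) where
        private
          Pₜ = classPrime t
          Pₜ-prime = p-prime (toℕ t)
          Pₜ<q : Pₜ < q
          Pₜ<q = subst (Pₜ <_) p≡q (p-mono-< (s≤s t<t₀))

        tally : cost (suc t) + friendCount Pₜ ≡ cost zero + enemyCount Pₜ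
        tally = begin
          cost (suc t) + friendCount Pₜ                      ≡⟨ cong (cost (suc t) +_) (friends≡ Pₜ-prime Pₜ<q) ⟨
          cost (suc t) + count (class? Pₜ ∩? friend?) n      ≡⟨ cost-suc t ⟩
          count friend? n + count (class? Pₜ ∩? enemy?) n    ≡⟨ cong₂ _+_ (sym cost-zero) (enemies≡ Pₜ-prime Pₜ<q) ⟩
          cost zero + enemyCount Pₜ                          ∎
          where open ≡-Reasoning

        earlier-loses : Wins Pₜ → cost (suc t₀) < cost (suc t)
        earlier-loses wins = +-cancelʳ-< (size q + enemyCount Pₜ) _ _ (begin-strict
          cost (suc t₀) + (size q + enemyCount Pₜ) ≡⟨ +-assoc (cost (suc t₀)) (size q) _ ⟨
          cost (suc t₀) + size q + enemyCount Pₜ   ≡⟨ cong (_+ enemyCount Pₜ) own-cost ⟩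
          cost zero + enemyCount Pₜ                ≡⟨ tally ⟨
          cost (suc t) + friendCount Pₜ            <⟨ +-monoʳ-< (cost (suc t)) wins ⟩
          cost (suc t) + (enemyCount Pₜ + size q)  ≡⟨ cong (cost (suc t) +_) (+-comm (enemyCount Pₜ) (size q)) ⟩
          cost (suc t) + (size q + enemyCount Pₜ)  ∎)
          where open ≤-Reasoning

        -- Equality is allowed because the earlier option prevails in a tie.
        earlier-wins : enemyCount Pₜ + size q ≤ friendCount Pₜ → cost (suc t) ≤ cost (suc t₀)
        earlier-wins loses = +-cancelʳ-≤ (size q + enemyCount Pₜ) _ _ (begin
          cost (suc t) + (size q + enemyCount Pₜ)  ≡⟨ cong (cost (suc t) +_) (+-comm (size q) (enemyCount Pₜ)) ⟩
          cost (suc t) + (enemyCount Pₜ + size q)  ≤⟨ +-monoʳ-≤ (cost (suc t)) loses ⟩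
          cost (suc t) + friendCount Pₜ            ≡⟨ tally ⟩
          cost zero + enemyCount Pₜ                ≡⟨ cong (_+ enemyCount Pₜ) own-cost ⟨
          cost (suc t₀) + size q + enemyCount Pₜ   ≡⟨ +-assoc (cost (suc t₀)) (size q) _ ⟩
          cost (suc t₀) + (size q + enemyCount Pₜ) ∎)
          where open ≤-Reasoning

      argmin≡own : (∀ t → toℕ t < toℕ t₀ → Wins (classPrime t)) → argmin cost ≡ suc t₀
      argmin≡own wins = argmin-unique cost (suc t₀)
        (λ { zero _ → own<zero ; (suc t) (s≤s t<t₀) → earlier-loses t t<t₀ (wins t t<t₀) })
        (λ { (suc t) (s≤s t₀<t) → later t (<⇒≤ t₀<t) })

      argmin≡first : ∀ t₁ → toℕ t₁ ≡ 0 → toℕ t₀ ≡ 1 →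
                     enemyCount (classPrime t₁) + size q ≤ friendCount (classPrime t₁) → argmin cost ≡ suc t₁
      argmin≡first t₁ t₁≡0 t₀≡1 loses = argmin-unique cost (suc t₁)
        (λ { zero _ → ≤-<-trans first≤own own<zero
           ; (suc t) (s≤s t<t₁) → contradiction (subst (toℕ t <_) t₁≡0 t<t₁) λ () })
        (λ { (suc t) (s≤s t₁<t) → ≤-trans first≤own
               (later t (subst (_≤ toℕ t) (trans (cong suc t₁≡0) (sym t₀≡1)) t₁<t)) })
        where
        first≤own : cost (suc t₁) ≤ cost (suc t₀)
        first≤own = earlier-wins t₁ (≤-reflexive (trans (cong suc t₁≡0) (sym t₀≡1))) loses

    -- The invariant gives N ≤ `p (suc M)`, and equality would make the composite N prime. Hence the
    -- class of `q` already exists.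
    N<p : N < p (suc M)
    N<p = ≤∧≢⇒< above λ N≡p →
      N≢q (sym (prime-∣-prime q-prime (subst Prime (sym N≡p) (p-prime M)) q∣N))

    own : ∃ λ t₀ → classPrime t₀ ≡ q
    own = let (i , p≡q) = p-surjective q-prime
              i<M = ≤-pred (p-cancel-< {suc i} (≤-<-trans (≤-trans (≤-reflexive p≡q) (∣⇒≤ q∣N)) N<p))
          in fromℕ< i<M , trans (cong (p ∘ suc) (toℕ-fromℕ< i<M)) p≡q

    stepComposite : N < n₀ → State N (greedyStep Ps N)
    stepComposite N<n₀ = subst (λ o → State N (apply Ps N o)) (sym argmin≡) record
      { represents = represents-%= t₀
          (λ {k} 1≤k k≢ → agree q-prime q∣N N-rough 1≤k λ pk≡q → k≢ (p-injective (trans pk≡q (sym p≡q))))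
          (λ {C} C≐ → extend C C≐) represents
      ; below = ≤-trans (≤-reflexive (cong p (length-%= Ps t₀ (_∷ʳ N)))) (m≤n⇒m≤1+n below)
      ; above = <-≤-trans N<p (≤-reflexive (cong (p ∘ suc) (sym (length-%= Ps t₀ (_∷ʳ N)))))
      }
      where
      t₀ : Fin M
      t₀ = proj₁ own
      p≡q : classPrime t₀ ≡ q
      p≡q = proj₂ own
      argmin≡ : argmin cost ≡ suc t₀
      argmin≡ = Own.argmin≡own t₀ p≡q λ t t<t₀ →
        Tally.wins-all n supp q-prime q∣N N-rough N≢q N<n₀ (p-prime (toℕ t))
          (subst (classPrime t <_) p≡q (p-mono-< (s≤s t<t₀)))
      p-injective : ∀ {i j} → p i ≡ p j → i ≡ j
      p-injective {i} {j} eq with <-cmp i j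
      ... | tri< i<j _ _ = contradiction eq (<⇒≢ (p-mono-< i<j))
      ... | tri≈ _ i≡j _ = i≡j
      ... | tri> _ _ j<i = contradiction (sym eq) (<⇒≢ (p-mono-< j<i))
      N∈S : S (suc (toℕ t₀)) N N
      N∈S = Class⇒S (s≤s z≤n) ≤-refl (subst (λ P → Class P N) (sym p≡q) (q∣N , N-rough))
      extend : ∀ C → (_∈ C) ≐ S (suc (toℕ t₀)) n → (_∈ C ∷ʳ N) ≐ S (suc (toℕ t₀)) N
      extend C (to , from) =
        (λ a∈ → [ (λ a∈C → S-mono {i = suc (toℕ t₀)} (n≤1+n n) (to a∈C)) , (λ { (here refl) → N∈S }) ]′ (∈-++⁻ C a∈)) ,
        λ {a} a∈S → back a a∈S (a ≟ N)
        where
        back : ∀ a → S (suc (toℕ t₀)) N a → Dec (a ≡ N) → a ∈ C ∷ʳ N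
        back a a∈S (yes refl) = ∈-++⁺ʳ C (here refl)
        back a a∈S (no a≢N)   = ∈-++⁺ˡ (from (S-pred {i = suc (toℕ t₀)} a≢N a∈S))

  step : N < n₀ → State N (greedyStep Ps N)
  step N<n₀ = go (smallestFactor N (s≤s 1≤n))
    where
    go : (∃ λ q → Prime q × q ∣ N × q Rough N) → State N (greedyStep Ps N)
    go (q , q-prime , q∣N , N-rough) = decide (N ≟ q)
      where
      decide : Dec (N ≡ q) → State N (greedyStep Ps N)
      decide (yes N≡q) = stepPrime (subst Prime (sym N≡q) q-prime)
      decide (no N≢q)  =
        Composite.stepComposite q-prime q∣N N-rough N≢q (proj₂ (support N (s≤s z≤n))) N<n₀

-- Induction below n₀ and the exceptional step

p₁≡2 : p 1 ≡ 2
p₁≡2 = ≤-antisym (p-least 0 (s≤s z≤n) prime[2]) (prime⇒2≤ (p-prime 0))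

p₂≡3 : p 2 ≡ 3
p₂≡3 = ≤-antisym (p-least 1 (subst (_< 3) (sym p₁≡2) ≤-refl) (toWitness {a? = prime? 3} _))
                 (subst (_< p 2) p₁≡2 (p-step 1))

G-state : ∀ n → 2 ≤ n → n < n₀ → State n (G n)
G-state 2 _ _ = record
  { represents = ((λ { (here refl) → 2∈S }) , λ {a} a∈S →
                     here (≤-antisym (proj₁ (proj₂ a∈S)) (subst (_≤ a) p₁≡2 (S⇒p≤ {i = 1} a∈S)))) ∷ []
  ; below = ≤-reflexive p₁≡2
  ; above = subst (_< p 2) p₁≡2 (p-step 1)
  }
  where
  2∈S : S 1 2 2
  2∈S = subst (S 1 2) p₁≡2 (p∈S {i = 0} (≤-reflexive p₁≡2))
G-state 1 (s≤s ()) _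
G-state (suc n@(suc (suc _))) _ N<n₀ =
  Step.step (s≤s (s≤s z≤n)) (G-state n (s≤s (s≤s z≤n)) (<-trans (n<1+n n) N<n₀)) N<n₀

module Exception where

  qs₀ : List ℕ
  qs₀ = 3 ∷ 5 ∷ 7 ∷ 11 ∷ 13 ∷ 17 ∷ 19 ∷ 23 ∷ []

  support₀ : Support n₀ qs₀
  support₀ = record
    { sorted   = toWitness {a? = allPairs? _<?_ qs₀} _
    ; primes   = primes₀
    ; divide   = toWitness {a? = all? (_∣? n₀) qs₀} _
    ; complete = λ q-prime q∣n₀ → factorisationHasAllPrimeFactors q-prime q∣n₀ primes₀
    }
    where
    primes₀ : All Prime qs₀
    primes₀ = toWitness {a? = all? prime? qs₀} _

  Exceptional : ℕ → Pred (Pred ℕ 0ℓ) 0ℓ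
  Exceptional N X = (X ≐ (S 1 N ∪ ｛ N ｝))
                  ⊎ (X ≐ (S 2 N ∖ ｛ N ｝))
                  ⊎ (∃[ j ] (3 ≤ j × Satisfiable (S j N) × X ≐ S j N))

  X₀ : ℕ → ℕ → Pred ℕ 0ℓ
  X₀ N 1 = S 1 N ∪ ｛ N ｝
  X₀ N 2 = S 2 N ∖ ｛ N ｝
  X₀ N k = S k N

  module _ {n : ℕ} (N≡n₀ : suc n ≡ n₀) {Ps : Partition} (2≤n : 2 ≤ n) (state : State n Ps) where
    open State state
    open Step 2≤n state

    private
      3-prime : Prime 3
      3-prime = toWitness {a? = prime? 3} _

      3∣N : 3 ∣ N
      3∣N = subst (3 ∣_) (sym N≡n₀) (toWitness {a? = 3 ∣? n₀} _)

      N-rough : 3 Rough N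
      N-rough = subst (3 Rough_) (sym N≡n₀) (toWitness {a? = 3 rough? n₀} _)

      N≢3 : N ≢ 3
      N≢3 N≡3 = contradiction (trans (sym N≡n₀) N≡3) λ ()

      supp : Support N qs₀
      supp = subst (λ N → Support N qs₀) (sym N≡n₀) support₀

    open Composite 3-prime 3∣N N-rough N≢3 supp
    open Tally n supp 3-prime 3∣N N-rough N≢3 using (friendCount; enemyCount; size; loses-2-3)

    2<1+M : 2 < suc M
    2<1+M = p-cancel-< (≤-<-trans (≤-trans (≤-reflexive p₂≡3) (∣⇒≤ 3∣N)) N<p)

    t₁ t₂ : Fin M
    t₁ = fromℕ< (<⇒≤ (≤-pred 2<1+M))
    t₂ = fromℕ< (≤-pred 2<1+M)

    t₁≡0 : toℕ t₁ ≡ 0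
    t₁≡0 = toℕ-fromℕ< _

    t₂≡1 : toℕ t₂ ≡ 1
    t₂≡1 = toℕ-fromℕ< _

    -- Here 3 φ(n₀) = 109486080 is at most n₀ = 111546435, so the criterion for the class of 2 turns
    -- around.
    loses : enemyCount 2 + size 3 ≤ friendCount 2
    loses = loses-2-3 ≤-refl refl (≤ᵇ⇒≤ (3 * totient qs₀) (1 * product qs₀) _)

    argmin≡1 : argmin cost ≡ suc t₁
    argmin≡1 = Own.argmin≡first t₂ (trans (cong (p ∘ suc) t₂≡1) p₂≡3) t₁ t₁≡0 t₂≡1
      (subst (λ P → enemyCount P + size 3 ≤ friendCount P) (sym (trans (cong (p ∘ suc) t₁≡0) p₁≡2)) loses)

    -- N has least prime factor 3 and so belongs to `S 2 N`, yet it is not put into that class: the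
    -- old `S 2 n` is `S 2 N` without N.
    agree₀ : ∀ {k} → 1 ≤ k → k ≢ 1 → S k n ≐ X₀ N k
    agree₀ {1} _ k≢1 = contradiction refl k≢1
    agree₀ {2} _ _ = (λ a∈S → S-mono {i = 2} (n≤1+n n) a∈S , λ N≡a → ≤n⇒≢N (proj₁ (proj₂ a∈S)) (sym N≡a)) ,
                     λ (a∈S , N≢a) → S-pred {i = 2} (N≢a ∘ sym) a∈S
    agree₀ {suc (suc (suc k))} _ _ = agree 3-prime 3∣N N-rough (s≤s z≤n) λ p≡3 →
      <⇒≢ (p-mono-< {2} {suc (suc (suc k))} (s≤s (s≤s (s≤s z≤n)))) (trans p₂≡3 (sym p≡3))

    extend₀ : ∀ {C} → (_∈ C) ≐ S 1 n → (_∈ C ∷ʳ N) ≐ X₀ N 1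
    extend₀ {C} (to , from) =
      (λ a∈ → [ (λ a∈C → inj₁ (S-mono {i = 1} (n≤1+n n) (to a∈C))) , (λ { (here refl) → inj₂ refl }) ]′ (∈-++⁻ C a∈)) ,
      λ { (inj₂ refl) → ∈-++⁺ʳ C (here refl) ; {a} (inj₁ a∈S) → back a a∈S (a ≟ N) }
      where
      back : ∀ a → S 1 N a → Dec (a ≡ N) → a ∈ C ∷ʳ N
      back a a∈S (yes refl) = ∈-++⁺ʳ C (here refl)
      back a a∈S (no a≢N)   = ∈-++⁺ˡ (from (S-pred {i = 1} a≢N a∈S))

    represents₀ : Represents (X₀ N) 1 (Ps [ t₁ ]%= (_∷ʳ N))
    represents₀ = represents-%= t₁
      (λ {k} 1≤k k≢ → agree₀ 1≤k λ k≡1 → k≢ (trans k≡1 (cong suc (sym t₁≡0))))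
      (λ {C} C≐ → reindex (X₀ N) (cong suc (sym t₁≡0)) (extend₀ (reindex (λ j → S j n) (cong suc t₁≡0) C≐)))
      represents

    exception : greedyStep Ps N ≋ Exceptional N
    exception = subst (λ o → apply Ps N o ≋ Exceptional N) (sym argmin≡1) (sound , complete)
      where
      Ps′ = Ps [ t₁ ]%= (_∷ʳ N)
      len : length Ps′ ≡ M
      len = length-%= Ps t₁ (_∷ʳ N)
      named : ∀ C k → 1 ≤ k → k < suc M → (_∈ C) ≐ X₀ N k → Exceptional N (_∈ C)
      named C 1 _ _ C≐ = inj₁ C≐
      named C 2 _ _ C≐ = inj₂ (inj₁ C≐)
      named C k@(suc (suc (suc _))) _ k<1+M C≐ =
        inj₂ (inj₂ (k , s≤s (s≤s (s≤s z≤n)) , S-satisfiable (m≤n⇒m≤1+n below) (s≤s z≤n) k<1+M , C≐))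
      sound : ∀ C → C ∈ Ps′ → Exceptional N (_∈ C)
      sound C C∈ = let (k , 1≤k , k< , C≐) = represents-∈ represents₀ C∈ in
        named C k 1≤k (subst (λ m → k < suc m) len k<) C≐
      find-class : ∀ {X} k → 1 ≤ k → k < suc M → X ≐ X₀ N k → ∃ λ C → C ∈ Ps′ × (_∈ C) ≐ X
      find-class k 1≤k k< X≐ =
        let (C , C∈ , C≐) = represents-∋ represents₀ 1≤k (subst (λ m → k < suc m) (sym len) k<) in
        C , C∈ , ≐-trans C≐ (≐-sym X≐)
      complete : ∀ X → Exceptional N X → ∃ λ C → C ∈ Ps′ × (_∈ C) ≐ X
      complete X (inj₁ X≐)        = find-class 1 ≤-refl (<-trans (n<1+n 1) 2<1+M) X≐
      complete X (inj₂ (inj₁ X≐)) = find-class 2 (s≤s z≤n) 2<1+M X≐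
      complete X (inj₂ (inj₂ (k@(suc (suc (suc _))) , s≤s (s≤s (s≤s z≤n)) , (a , a∈S) , X≐))) =
        find-class k (s≤s z≤n) (S⇒index {j = k} N<p a∈S) X≐

-- With a variable in place of `n₀`, matching on `suc` unfolds exactly one greedy step.
G-exception : ∀ N → N ≡ n₀ → G N ≋ Exception.Exceptional N
G-exception (suc n@(suc (suc _))) N≡n₀ =
  Exception.exception N≡n₀ (s≤s (s≤s z≤n)) (G-state n (s≤s (s≤s z≤n)) (≤-reflexive N≡n₀))

theorem1 : (∀ (m : ℕ) → 2 ≤ m → m < n₀ →
    G m ≋ (λ X → ∃[ j ] (1 ≤ j × Satisfiable (S j m) × X ≐ S j m)))
    × (G n₀ ≋ (λ X → (X ≐ (S 1 n₀ ∪ ｛ n₀ ｝))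
    ⊎ (X ≐ (S 2 n₀ ∖ ｛ n₀ ｝))
    ⊎ (∃[ j ] (3 ≤ j × Satisfiable (S j n₀) × X ≐ S j n₀))))
theorem1 = (λ m 2≤m m<n₀ → state⇒≋ (G-state m 2≤m m<n₀)) , G-exception n₀ refl
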